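{- Let $1\le k\le d-1$ be integers. If $d-k$ is even, then $$n(k,d)\le \min_{0\le h\le \frac{d-k-2}{2}}\max\left\{2^h\sum_{j=0}^{k}\binom{d-h}{j},\ \sum_{j=h+1}^{\frac{d-k-2}{2}}\left(\frac{1}{2^{j+1}}-\frac{1}{2^{d-k-j}}\right)\left|B_{k+2j}^{(d)}\right|+2^{\frac{d+k}{2}}\right\}.$$ If $d-k$ is odd, then $$n(k,d)\le \min_{0\le h\le \frac{d-k-3}{2}}\max\left\{2^h\sum_{j=0}^{k}\binom{d-h}{j},\ \sum_{j=h+1}^{\frac{d-k-3}{2}}\left(\frac{1}{2^{j+1}}-\frac{1}{2^{d-k-j}}\right)\left|B_{k+2j}^{(d)}\right|+\frac{1}{2^{\frac{d-k+1}{2}}}\left|B_{d-1}^{(d)}\right|+2^{\frac{d+k-1}{2}}\right\},$$ and also $$n(k,d)\le \max\left\{2^{\frac{d-k-1}{2}}\sum_{j=0}^{k}\binom{\frac{d+k+1}{2}}{j},\ 2^{\frac{d+k-1}{2}}\right\}.$$ Here the minima are over integers $h$.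
   Context: A standard box in $\mathbb{R}^d$ is a set $K=K_1\times\cdots\times K_d$ where each $K_i\subseteq\mathbb{R}$ is a closed interval. A finite family of $d$-dimensional standard boxes in $\mathbb{R}^d$ is called $k$-neighborly if the dimension of the intersection of any two distinct members is in $\{d-k,d-k+1,\ldots,d-1\}$ (in particular the intersection is nonempty). For positive integers $1\le k\le d$, $n(k,d)$ is the maximum number of members of a $k$-neighborly family of $d$-dimensional standard boxes in $\mathbb{R}^d$. For a nonnegative integer $m\le d-1$, the configuration $B_m^{(d)}\subseteq\{0,1\}^d$ is defined as follows: if $m=2t$, it is the set of binary vectors of length $d$ with at most $t$ coordinates equal to $1$; if $m=2t+1$, it is the Cartesian product of $\{0,1\}$ with the set of binary vectors of length $d-1$ with at most $t$ coordinates equal to $1$. Thus $|B_m^{(d)}|=\sum_{i=0}^{t}\binom{d}{i}$ if $m=2t$, and $|B_m^{(d)}|=2\sum_{i=0}^{t}\binom{d-1}{i}$ if $m=2t+1$. Empty sums (upper limit smaller than the lower limit) equal $0$. A minimum over an empty range of $h$ (which occurs only when $d-k=1$) is read as $+\infty$, i.e. that particular bound is void. -}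

module Defs where

open import Data.Empty using (⊥)
open import Data.Fin.Subset using (Subset; inside; outside; ∣_∣)
open import Data.Integer.Base using (+_)
open import Data.List.Base as List using (List; []; _∷_)
open import Data.Nat.Base as ℕ using (ℕ; zero; suc; ⌊_/2⌋; parity; _^_)
open import Data.Nat.Combinatorics using (_C_)
open import Data.Nat.ListAction using (sum)
import Data.Nat.Properties as ℕ
open import Data.Parity.Base using (Parity; 0ℙ; 1ℙ)
open import Data.Product.Base using (Σ; ∃-syntax; _×_; _,_)
open import Data.Rational.Base as ℚ using (ℚ; 0ℚ; 1ℚ; ½)
import Data.Rational.Properties as ℚ
open import Data.Rational.Solver using (module +-*-Solver)
open import Data.Vec.Base using ([]; _∷_)
open import Data.Vec.Functional as Vector using (Vector)
open import Level using (0ℓ)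
open import Relation.Binary.PropositionalEquality
  using (_≡_; _≢_; refl; sym; cong; subst; subst₂; module ≡-Reasoning)
open import Relation.Nullary using (¬_; no)
open import Relation.Unary using (Pred; _∩_; Decidable)

------------------------------------------------------------------------
-- Real numbers: Cauchy sequences of rationals, with equality _≈_
-- (difference tending to 0) in place of a quotient.

record ℝ : Set where
  field
    seq    : ℕ → ℚ
    cauchy : ∀ ε → 0ℚ ℚ.< ε →
             ∃[ N ] (∀ m n → N ℕ.≤ m → N ℕ.≤ n → ℚ.∣ seq m ℚ.- seq n ∣ ℚ.< ε)

open ℝ public

infix  4 _≈_ _≤_
infixl 6 _+_
infixl 7 _*_

_≈_ : ℝ → ℝ → Set
x ≈ y = ∀ ε → 0ℚ ℚ.< ε →
        ∃[ N ] (∀ n → N ℕ.≤ n → ℚ.∣ seq x n ℚ.- seq y n ∣ ℚ.< ε)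

_≤_ : ℝ → ℝ → Set
x ≤ y = ∀ ε → 0ℚ ℚ.< ε → ∃[ N ] (∀ n → N ℕ.≤ n → seq x n ℚ.≤ seq y n ℚ.+ ε)

0ℝ : ℝ
0ℝ .seq _ = 0ℚ
0ℝ .cauchy ε 0<ε = 0 , λ _ _ _ _ → 0<ε

private

  halve : ∀ ε → ½ ℚ.* ε ℚ.+ ½ ℚ.* ε ≡ ε
  halve ε = begin
    ½ ℚ.* ε ℚ.+ ½ ℚ.* ε   ≡⟨ ℚ.*-distribʳ-+ ε ½ ½ ⟨
    1ℚ ℚ.* ε              ≡⟨ ℚ.*-identityˡ ε ⟩
    ε                     ∎
    where open ≡-Reasoning

  0<½ε : ∀ {ε} → 0ℚ ℚ.< ε → 0ℚ ℚ.< ½ ℚ.* ε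
  0<½ε {ε} 0<ε = ℚ.positive⁻¹ (½ ℚ.* ε) {{ℚ.pos*pos⇒pos ½ ε {{ℚ.positive 0<ε}}}}

_+_ : ℝ → ℝ → ℝ
(x + y) .seq n = seq x n ℚ.+ seq y n
(x + y) .cauchy ε 0<ε with cauchy x (½ ℚ.* ε) (0<½ε 0<ε) | cauchy y (½ ℚ.* ε) (0<½ε 0<ε)
... | N₁ , close₁ | N₂ , close₂ = N₁ ℕ.⊔ N₂ , λ m n N≤m N≤n →
  subst₂ (λ a b → ℚ.∣ a ∣ ℚ.< b) (sym (regroup (seq x m) (seq y m) (seq x n) (seq y n))) (halve ε)
    (ℚ.≤-<-trans (ℚ.∣p+q∣≤∣p∣+∣q∣ (seq x m ℚ.- seq x n) (seq y m ℚ.- seq y n))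
      (ℚ.+-mono-<
        (close₁ m n (ℕ.m⊔n≤o⇒m≤o N₁ N₂ N≤m) (ℕ.m⊔n≤o⇒m≤o N₁ N₂ N≤n))
        (close₂ m n (ℕ.m⊔n≤o⇒n≤o N₁ N₂ N≤m) (ℕ.m⊔n≤o⇒n≤o N₁ N₂ N≤n))))
  where
  regroup : ∀ a b c d → (a ℚ.+ b) ℚ.- (c ℚ.+ d) ≡ (a ℚ.- c) ℚ.+ (b ℚ.- d)
  regroup = solve 4 (λ a b c d → (a :+ b) :- (c :+ d) := (a :- c) :+ (b :- d)) refl
    where open +-*-Solver

private

  eventuallyBounded : ∀ x → ∃[ K ] ∃[ N ]
    (0ℚ ℚ.< K × (∀ n → N ℕ.≤ n → ℚ.∣ seq x n ∣ ℚ.≤ K))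
  eventuallyBounded x with cauchy x 1ℚ (ℚ.positive⁻¹ 1ℚ)
  ... | N , close = K , N , 0<K , bound
    where
    K : ℚ
    K = 1ℚ ℚ.+ ℚ.∣ seq x N ∣
    0<K : 0ℚ ℚ.< K
    0<K = ℚ.+-mono-<-≤ (ℚ.positive⁻¹ 1ℚ) (ℚ.0≤∣p∣ (seq x N))
    split : ∀ a b → a ≡ (a ℚ.- b) ℚ.+ b
    split = solve 2 (λ a b → a := (a :- b) :+ b) refl
      where open +-*-Solver
    bound : ∀ n → N ℕ.≤ n → ℚ.∣ seq x n ∣ ℚ.≤ K
    bound n N≤n = subst (λ a → ℚ.∣ a ∣ ℚ.≤ K) (sym (split (seq x n) (seq x N)))
      (ℚ.≤-trans (ℚ.∣p+q∣≤∣p∣+∣q∣ (seq x n ℚ.- seq x N) (seq x N))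
        (ℚ.+-monoˡ-≤ ℚ.∣ seq x N ∣ (ℚ.<⇒≤ (close n N N≤n ℕ.≤-refl))))

private

  divide : ∀ S ε → 0ℚ ℚ.< S → 0ℚ ℚ.< ε → ∃[ δ ] (0ℚ ℚ.< δ × S ℚ.* δ ≡ ε)
  divide S ε 0<S 0<ε = (1/S ℚ.* ε) , 0<δ , (begin
    S ℚ.* (1/S ℚ.* ε)   ≡⟨ ℚ.*-assoc S 1/S ε ⟨
    S ℚ.* 1/S ℚ.* ε     ≡⟨ cong (ℚ._* ε) (ℚ.*-inverseʳ S {{S≢0}}) ⟩
    1ℚ ℚ.* ε            ≡⟨ ℚ.*-identityˡ ε ⟩
    ε                   ∎)
    where
    open ≡-Reasoning
    S≢0 : ℚ.NonZero S
    S≢0 = ℚ.pos⇒nonZero S {{ℚ.positive 0<S}}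
    1/S : ℚ
    1/S = (ℚ.1/ S) {{S≢0}}
    0<δ : 0ℚ ℚ.< 1/S ℚ.* ε
    0<δ = ℚ.positive⁻¹ (1/S ℚ.* ε)
      {{ℚ.pos*pos⇒pos 1/S {{ℚ.1/pos⇒pos S {{ℚ.positive 0<S}}}} ε {{ℚ.positive 0<ε}}}}

  productBound : ∀ {P δ} p q → 0ℚ ℚ.< P → ℚ.∣ p ∣ ℚ.≤ P → ℚ.∣ q ∣ ℚ.< δ →
                 ℚ.∣ p ℚ.* q ∣ ℚ.< P ℚ.* δ
  productBound {P} {δ} p q 0<P p≤P q<δ = subst (ℚ._< P ℚ.* δ) (sym (ℚ.∣p*q∣≡∣p∣*∣q∣ p q))
    (ℚ.≤-<-trans
      (ℚ.*-monoʳ-≤-nonNeg ℚ.∣ q ∣ {{ℚ.nonNegative (ℚ.0≤∣p∣ q)}} p≤P)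
      (ℚ.*-monoʳ-<-pos P {{ℚ.positive 0<P}} q<δ))

  productDifference : ∀ {K L δ} a b c d → 0ℚ ℚ.< K → 0ℚ ℚ.< L →
    ℚ.∣ a ∣ ℚ.≤ K → ℚ.∣ d ∣ ℚ.≤ L → ℚ.∣ a ℚ.- c ∣ ℚ.< δ → ℚ.∣ b ℚ.- d ∣ ℚ.< δ →
    ℚ.∣ a ℚ.* b ℚ.- c ℚ.* d ∣ ℚ.< (K ℚ.+ L) ℚ.* δ
  productDifference {K} {L} {δ} a b c d 0<K 0<L a≤K d≤L a-c<δ b-d<δ =
    subst₂ (λ u v → ℚ.∣ u ∣ ℚ.< v) (sym (regroup a b c d)) (sym (ℚ.*-distribʳ-+ δ K L))
      (ℚ.≤-<-trans (ℚ.∣p+q∣≤∣p∣+∣q∣ (a ℚ.* (b ℚ.- d)) (d ℚ.* (a ℚ.- c)))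
        (ℚ.+-mono-<
          (productBound a (b ℚ.- d) 0<K a≤K b-d<δ)
          (productBound d (a ℚ.- c) 0<L d≤L a-c<δ)))
    where
    regroup : ∀ a b c d → a ℚ.* b ℚ.- c ℚ.* d ≡ a ℚ.* (b ℚ.- d) ℚ.+ d ℚ.* (a ℚ.- c)
    regroup = solve 4 (λ a b c d → a :* b :- c :* d := a :* (b :- d) :+ d :* (a :- c)) refl
      where open +-*-Solver

  productCauchy : ∀ x y {K L M₁ M₂} ε → 0ℚ ℚ.< K → 0ℚ ℚ.< L →
    (∀ n → M₁ ℕ.≤ n → ℚ.∣ seq x n ∣ ℚ.≤ K) →
    (∀ n → M₂ ℕ.≤ n → ℚ.∣ seq y n ∣ ℚ.≤ L) →
    ∃[ δ ] (0ℚ ℚ.< δ × (K ℚ.+ L) ℚ.* δ ≡ ε) →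
    ∃[ N ] (∀ m n → N ℕ.≤ m → N ℕ.≤ n →
            ℚ.∣ seq x m ℚ.* seq y m ℚ.- seq x n ℚ.* seq y n ∣ ℚ.< ε)
  productCauchy x y {K} {L} {M₁} {M₂} ε 0<K 0<L bound₁ bound₂ (δ , 0<δ , [K+L]δ≡ε)
    with cauchy x δ 0<δ | cauchy y δ 0<δ
  ... | N₁ , close₁ | N₂ , close₂ = (M₁ ℕ.⊔ M₂) ℕ.⊔ (N₁ ℕ.⊔ N₂) , λ m n N≤m N≤n →
    subst (ℚ.∣ seq x m ℚ.* seq y m ℚ.- seq x n ℚ.* seq y n ∣ ℚ.<_) [K+L]δ≡ε
      (productDifference (seq x m) (seq y m) (seq x n) (seq y n) 0<K 0<L
        (bound₁ m (ℕ.m⊔n≤o⇒m≤o M₁ M₂ (M≤ N≤m)))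
        (bound₂ n (ℕ.m⊔n≤o⇒n≤o M₁ M₂ (M≤ N≤n)))
        (close₁ m n (ℕ.m⊔n≤o⇒m≤o N₁ N₂ (N≤ N≤m)) (ℕ.m⊔n≤o⇒m≤o N₁ N₂ (N≤ N≤n)))
        (close₂ m n (ℕ.m⊔n≤o⇒n≤o N₁ N₂ (N≤ N≤m)) (ℕ.m⊔n≤o⇒n≤o N₁ N₂ (N≤ N≤n))))
    where
    M≤ : ∀ {o} → (M₁ ℕ.⊔ M₂) ℕ.⊔ (N₁ ℕ.⊔ N₂) ℕ.≤ o → M₁ ℕ.⊔ M₂ ℕ.≤ o
    M≤ = ℕ.m⊔n≤o⇒m≤o (M₁ ℕ.⊔ M₂) (N₁ ℕ.⊔ N₂)
    N≤ : ∀ {o} → (M₁ ℕ.⊔ M₂) ℕ.⊔ (N₁ ℕ.⊔ N₂) ℕ.≤ o → N₁ ℕ.⊔ N₂ ℕ.≤ o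
    N≤ = ℕ.m⊔n≤o⇒n≤o (M₁ ℕ.⊔ M₂) (N₁ ℕ.⊔ N₂)

_*_ : ℝ → ℝ → ℝ
(x * y) .seq n = seq x n ℚ.* seq y n
(x * y) .cauchy ε 0<ε = let
    K , _ , 0<K , bound₁ = eventuallyBounded x
    L , _ , 0<L , bound₂ = eventuallyBounded y
  in productCauchy x y ε 0<K 0<L bound₁ bound₂
       (divide (K ℚ.+ L) ε (ℚ.+-mono-< 0<K 0<L) 0<ε)

------------------------------------------------------------------------
-- Affine dimension of subsets of ℝᵈ

ℝ^ : ℕ → Set
ℝ^ d = Vector ℝ d

∑ : ∀ {m} → Vector ℝ m → ℝ
∑ = Vector.foldr _+_ 0ℝ

AffinelyIndependent : ∀ {d m} → Vector (ℝ^ d) m → Set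
AffinelyIndependent {d} {m} p =
  (c : Vector ℝ m) →
  ∑ c ≈ 0ℝ →
  (∀ i → ∑ (λ j → c j * p j i) ≈ 0ℝ) →
  ∀ j → c j ≈ 0ℝ

ContainsIndependent : ∀ {d} → ℕ → Pred (ℝ^ d) 0ℓ → Set
ContainsIndependent {d} m S =
  Σ (Vector (ℝ^ d) m) λ p → (∀ j → S (p j)) × AffinelyIndependent p

-- The empty set has no dimension in this sense, so HasDimension S m
-- also says that S is nonempty.
HasDimension : ∀ {d} → Pred (ℝ^ d) 0ℓ → ℕ → Set
HasDimension S m = ContainsIndependent (suc m) S × ¬ ContainsIndependent (suc (suc m)) S

------------------------------------------------------------------------
-- Neighborly families of standard boxes

record ClosedInterval : Set where
  field
    lower upper : ℝ
    lower≤upper : lower ≤ upper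

open ClosedInterval public

Box : ℕ → Set
Box d = Vector ClosedInterval d

⟦_⟧ : ∀ {d} → Box d → Pred (ℝ^ d) 0ℓ
⟦ K ⟧ x = ∀ i → lower (K i) ≤ x i × x i ≤ upper (K i)

-- A family of N members is indexed by Fin N.  Members with different
-- indices are different sets: each has dimension d, while pairwise
-- intersections have dimension less than d.  The two inequalities on m
-- say d - k ≤ m ≤ d - 1.
record IsNeighborly (k : ℕ) {d N : ℕ} (F : Vector (Box d) N) : Set where
  field
    fullDimensional : ∀ a → HasDimension ⟦ F a ⟧ d
    intersections   : ∀ a b → a ≢ b →
      ∃[ m ] (d ℕ.≤ m ℕ.+ k × m ℕ.< d × HasDimension (⟦ F a ⟧ ∩ ⟦ F b ⟧) m)

fromℕ : ℕ → ℚ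
fromℕ n = + n ℚ./ 1

infix 4 n[_,_]≤_

-- n(k,d) is a maximum of cardinalities, so n(k,d) ≤ X means that no
-- k-neighborly family has more than X members.
n[_,_]≤_ : ℕ → ℕ → ℚ → Set
n[ k , d ]≤ X = ∀ N (F : Vector (Box d) N) → IsNeighborly k F → fromℕ N ℚ.≤ X

------------------------------------------------------------------------
-- The configurations B_m^(d).  A binary vector is a Subset, and ∣ v ∣
-- is its number of coordinates equal to 1.

-- Configuration π t is B_m for m = 2t (π = 0ℙ) or m = 2t + 1 (π = 1ℙ).
-- The case π = 1ℙ, d = 0 does not arise when m ≤ d - 1.
Configuration : Parity → ℕ → ∀ {d} → Pred (Subset d) 0ℓ
Configuration 0ℙ t v       = ∣ v ∣ ℕ.≤ t
Configuration 1ℙ t (_ ∷ v) = ∣ v ∣ ℕ.≤ t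
Configuration 1ℙ t []      = ⊥

B : ℕ → ∀ d → Pred (Subset d) 0ℓ
B m d = Configuration (parity m) ⌊ m /2⌋

configuration? : ∀ π t {d} → Decidable (Configuration π t {d})
configuration? 0ℙ t v       = ∣ v ∣ ℕ.≤? t
configuration? 1ℙ t (_ ∷ v) = ∣ v ∣ ℕ.≤? t
configuration? 1ℙ t []      = no λ ()

B? : ∀ m d → Decidable (B m d)
B? m d = configuration? (parity m) ⌊ m /2⌋

binaryVectors : ∀ d → List (Subset d)
binaryVectors zero    = [] ∷ []
binaryVectors (suc d) =
  List.cartesianProductWith _∷_ (outside ∷ inside ∷ []) (binaryVectors d)

∣B∣ : ℕ → ℕ → ℕ
∣B∣ m d = List.length (List.filter (B? m d) (binaryVectors d))

------------------------------------------------------------------------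
-- Sums and powers in the bounds

-- C(n,0) + … + C(n,k)
binomialSum : ℕ → ℕ → ℕ
binomialSum n k = sum (List.map (n C_) (List.upTo (suc k)))

-- f a + … + f b, which is 0 when b < a
sumFromTo : ℕ → ℕ → (ℕ → ℚ) → ℚ
sumFromTo a b f = List.foldr ℚ._+_ 0ℚ (List.map f (List.applyUpTo (a ℕ.+_) (suc b ℕ.∸ a)))

1/2^ : ℕ → ℚ
1/2^ n = (+ 1 ℚ./ (2 ^ n)) {{ℕ.m^n≢0 2 n}}

{-# OPTIONS --safe #-}
module Submission where

-- Classically each box becomes a word over {0, 1, *}: its i-th letter is 0 or 1 if the i-th side
-- only touches some other side from below or from above, and * otherwise. Two boxes then
-- intersect in dimension d minus the number of positions where one word has 0 and the other 1,
-- so any two words of a k-neighborly family conflict in between 1 and k positions. The bounds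
-- are decidable, so this translation is needed only up to double negation.
--
-- A word with s stars is a face of the cube with 2^s vertices; the faces are disjoint. Let S j be
-- the number of vertices on faces with at most j stars. Such vertices are at Hamming distance at
-- most k + 2 j, so S j ≤ |B_(k+2j)| by Kleitman's diameter theorem, and S i + S j ≤ 2^d if
-- i + j = d - k - 1, since no vertex counted by S i is antipodal to one counted by S j. If every
-- word has more than h stars, the size of the family is ∑_(j>h) S j / 2^(j+1), and pairing j with
-- d - k - 1 - j gives the second entry of the maximum. If some word has at most h stars, sending
-- every word to its vertex nearest to that face is injective and gives the first entry.

open import Algebra.Bundles using (CommutativeRing)
open import Data.Fin.Base using (Fin; zero; suc; punchIn; punchOut)
import Data.Fin.Properties as Fin
open import Data.List.Base as List using (List; []; _∷_; length; filter)
open import Data.List.Membership.Propositional using (_∈_)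
open import Data.List.Membership.Propositional.Properties using (∈-map⁺; ∈-allFin)
import Data.List.Properties as List
open import Data.List.Relation.Unary.All as All using (All; []; _∷_)
import Data.List.Relation.Unary.All.Properties as All
open import Data.List.Relation.Unary.Any using (here; there)
open import Data.Nat.Base as ℕ using (ℕ; zero; suc; z≤n; s≤s; s≤s⁻¹; _<_)
import Data.Nat.Properties as ℕ
open import Data.Product.Base using (∃-syntax; _×_; _,_; proj₁; proj₂)
open import Data.Sum.Base as Sum using (_⊎_; inj₁; inj₂)
open import Data.Vec.Functional as Vector using (Vector)
import Data.Vec.Functional.Properties as Vector
open import Function.Base using (_∘_)
open import Level using (0ℓ) renaming (_⊔_ to _⊔ˡ_)
import Relation.Binary.PropositionalEquality as ≡
open ≡ using (_≡_; _≢_)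
open import Relation.Nullary using (¬_; Dec; yes; no; does; contradiction)
open import Relation.Nullary.Decidable using (decidable-stable; dec-true; ¬¬-excluded-middle)
open import Relation.Unary using (Pred; Decidable; _∩_)

-- Linear algebra without division

-- Equality and order of Cauchy reals are not decidable, which rules out elimination with a choice
-- of pivot. But dimensions are only used to derive contradictions: too many conflicts contradict
-- the existence of independent points, and no conflict contradicts a bound on their number. For
-- this, stability and cancellation suffice.
--
-- That a letter can be attached to a single box instead of a pair is a one-dimensional fact: sides
-- that meet pairwise leave no room between two places where sides touch.
--
-- The weights come from a geometric series: 1/2^s is the sum of 1/2^(j+1) over j ≥ s, so each face
-- with s stars contributes 1. The series is cut off where the window of indices is symmetric under
-- the pairing, and the remainder is paid for by the 2^d vertices of the cube. The partner of j has
-- the smaller weight 1/2^(d-k-j); that much of the weight of S j is spent on S j + S (d-k-1-j) ≤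
-- 2^d, and the difference of the two powers is left for Kleitman's bound. What a pair spends
-- doubles the remainder, which grows in this way to the last power of 2 in the theorem.

-- An integral domain in which x ≈ 0 is stable under double negation; no element need be
-- decidably 0 or invertible.
record IsStableDomain {c ℓ} (R : CommutativeRing c ℓ) : Set (c ⊔ˡ ℓ) where
  open CommutativeRing R hiding (zero)
  field
    stable     : ∀ x → ¬ ¬ x ≈ 0# → x ≈ 0#
    domain     : ∀ x y → ¬ x ≈ 0# → x * y ≈ 0# → y ≈ 0#
    nontrivial : ¬ 1# ≈ 0#

module LinearAlgebra {c ℓ} {R : CommutativeRing c ℓ} (isStableDomain : IsStableDomain R) where

  open CommutativeRing R hiding (zero)
  open IsStableDomain isStableDomain
  open import Algebra.Properties.Ring ring using (-‿distribˡ-*; -‿distribʳ-*)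
  open import Algebra.Properties.Semiring.Sum semiring
  open import Relation.Binary.Reasoning.Setoid setoid

  sum-zero : ∀ {n} {t : Vector Carrier n} → (∀ i → t i ≈ 0#) → sum t ≈ 0#
  sum-zero {n} t≈0 = trans (sum-cong-≋ t≈0) (sum-replicate-zero n)

  dot : ∀ {n} → Vector Carrier n → Vector Carrier n → Carrier
  dot r y = sum (λ i → r i * y i)

  OnlyTrivialKernel : ∀ {n} → List (Vector Carrier n) → Set _
  OnlyTrivialKernel rs = ∀ y → All (λ r → dot r y ≈ 0#) rs → ∀ i → y i ≈ 0#

  -- Fraction-free elimination of the variable j by means of the row r.
  eliminate : ∀ {n} → Vector Carrier (suc n) → Fin (suc n) → Vector Carrier (suc n) → Vector Carrier n
  eliminate r j r′ l = r j * r′ (punchIn j l) + (- r′ j) * r (punchIn j l)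

  -- Back substitution matching `eliminate`: the entry at j makes the row r vanish, and scaling the
  -- other entries by `r j` replaces the division by the pivot.
  lift : ∀ {n} → Vector Carrier (suc n) → Fin (suc n) → Vector Carrier n → Vector Carrier (suc n)
  lift r j y = Vector.insertAt (λ l → r j * y l) j (- sum (λ l → r (punchIn j l) * y l))

  dot-lift : ∀ {n} (r : Vector Carrier (suc n)) j r′ y → dot r′ (lift r j y) ≈ dot (eliminate r j r′) y
  dot-lift r j r′ y = begin
    dot r′ (lift r j y)
      ≈⟨ sum-remove {i = j} (λ i → r′ i * lift r j y i) ⟩
    r′ j * lift r j y j + sum (λ l → r′ (punchIn j l) * lift r j y (punchIn j l))
      ≡⟨ ≡.cong₂ _+_ (≡.cong (r′ j *_) (Vector.insertAt-lookup _ j _))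
           (sum-cong-≗ (λ l → ≡.cong (r′ (punchIn j l) *_) (Vector.insertAt-punchIn _ j _ l))) ⟩
    r′ j * (- T) + sum (λ l → r′ (punchIn j l) * (r j * y l))
      ≈⟨ +-congʳ (trans (sym (-‿distribʳ-* (r′ j) T)) (-‿distribˡ-* (r′ j) T)) ⟩
    (- r′ j) * T + sum (λ l → r′ (punchIn j l) * (r j * y l))
      ≈⟨ +-congʳ (*-distribˡ-sum (- r′ j) (λ l → r (punchIn j l) * y l)) ⟩
    sum (λ l → (- r′ j) * (r (punchIn j l) * y l)) + sum (λ l → r′ (punchIn j l) * (r j * y l))
      ≈⟨ +-comm _ _ ⟩
    sum (λ l → r′ (punchIn j l) * (r j * y l)) + sum (λ l → (- r′ j) * (r (punchIn j l) * y l))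
      ≈⟨ ∑-distrib-+ (λ l → r′ (punchIn j l) * (r j * y l)) (λ l → (- r′ j) * (r (punchIn j l) * y l)) ⟨
    sum (λ l → r′ (punchIn j l) * (r j * y l) + (- r′ j) * (r (punchIn j l) * y l))
      ≈⟨ sum-cong-≋ (λ l → sym (expand (r′ (punchIn j l)) (r (punchIn j l)) (y l))) ⟩
    dot (eliminate r j r′) y ∎
    where
    T = sum (λ l → r (punchIn j l) * y l)
    expand : ∀ a b z → (r j * a + (- r′ j) * b) * z ≈ a * (r j * z) + (- r′ j) * (b * z)
    expand a b z = trans (distribʳ z (r j * a) ((- r′ j) * b))
      (+-cong (trans (*-congʳ (*-comm (r j) a)) (*-assoc a (r j) z)) (*-assoc (- r′ j) b z))

  eliminate-self : ∀ {n} (r : Vector Carrier (suc n)) j l → eliminate r j r l ≈ 0#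
  eliminate-self r j l = trans (sym (distribʳ _ (r j) (- r j)))
    (trans (*-congʳ (-‿inverseʳ (r j))) (zeroˡ _))

  underdetermined : ∀ {n} (rs : List (Vector Carrier n)) → length rs < n → ¬ OnlyTrivialKernel rs
  underdetermined {suc n} []       _           trivial = nontrivial (trivial (λ _ → 1#) [] zero)
  underdetermined {suc n} (r ∷ rs) (s≤s len<n) trivial =
    underdetermined rs (ℕ.m≤n⇒m≤1+n len<n)
      (λ y ker → trivial y (sum-zero (λ i → trans (*-congʳ (r≈0 i)) (zeroˡ (y i))) ∷ ker))
    where
    r≈0 : ∀ j → r j ≈ 0#
    r≈0 j = stable (r j) λ rⱼ≉0 →
      underdetermined (List.map (eliminate r j) rs)
        (ℕ.≤-trans (s≤s (ℕ.≤-reflexive (List.length-map (eliminate r j) rs))) len<n)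
        (λ y ker l → domain (r j) (y l) rⱼ≉0
          (trans (reflexive (≡.sym (Vector.insertAt-punchIn _ j _ l)))
            (trivial (lift r j y)
              ( trans (dot-lift r j r y) (sum-zero (λ l → trans (*-congʳ (eliminate-self r j l)) (zeroˡ (y l))))
              ∷ All.map (λ {r′} → trans (dot-lift r j r′ y)) (All.map⁻ ker))
              (punchIn j l))))

  Independent : ∀ {d m} → Vector (Vector Carrier d) m → Set _
  Independent {d} {m} p = (c : Vector Carrier m) → sum c ≈ 0# →
    (∀ i → sum (λ j → c j * p j i) ≈ 0#) → ∀ j → c j ≈ 0#

  -- Independence says that the homogeneous system with a row of ones and one row per coordinate has
  -- trivial kernel. The row of a fixed coordinate is a multiple of the row of ones, so only
  -- `suc (length free)` equations remain for m unknowns.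
  dependent : ∀ {d m} (p : Vector (Vector Carrier d) m) (free : List (Fin d)) (x : Vector Carrier d) →
    (∀ i → i ∈ free ⊎ (∀ j → p j i ≈ x i)) → suc (length free) < m → ¬ Independent p
  dependent {d} {m} p free x fixed len<m independent = underdetermined rows
    (ℕ.≤-trans (ℕ.≤-reflexive (≡.cong (2 ℕ.+_) (List.length-map (λ i j → p j i) free))) len<m) trivial
    where
    rows : List (Vector Carrier m)
    rows = (λ _ → 1#) ∷ List.map (λ i j → p j i) free
    trivial : OnlyTrivialKernel rows
    trivial c (∑1c≈0 ∷ ker) = independent c ∑c≈0 ∑cp≈0
      where
      ∑c≈0 : sum c ≈ 0#
      ∑c≈0 = trans (sum-cong-≋ (λ j → sym (*-identityˡ (c j)))) ∑1c≈0
      ∑cp≈0 : ∀ i → sum (λ j → c j * p j i) ≈ 0#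
      ∑cp≈0 i with fixed i
      ... | inj₁ i∈free = trans (sum-cong-≋ (λ j → *-comm (c j) (p j i))) (All.lookup (All.map⁻ ker) i∈free)
      ... | inj₂ pᵢ≈xᵢ = begin
        sum (λ j → c j * p j i)   ≈⟨ sum-cong-≋ (λ j → *-congˡ (pᵢ≈xᵢ j)) ⟩
        sum (λ j → c j * x i)     ≈⟨ *-distribʳ-sum (x i) c ⟨
        sum c * x i               ≈⟨ *-congʳ ∑c≈0 ⟩
        0# * x i                  ≈⟨ zeroˡ (x i) ⟩
        0#                        ∎

  corner : ∀ {d} → Vector Carrier d → Vector Carrier d → Vector (Vector Carrier d) (suc d)
  corner L U zero    = L
  corner L U (suc i) = Vector.updateAt L i (λ _ → U i)

  -- Subtracting `L i` times the equation for the sum of c from the i-th coordinate equation kills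
  -- every summand except that of the corner displaced in direction i, which is multiplied by the
  -- nonzero edge length.
  corner-independent : ∀ {d} (L U : Vector Carrier d) → (∀ i → ¬ U i + - L i ≈ 0#) → Independent (corner L U)
  corner-independent {d} L U nondegenerate c ∑c≈0 ∑cp≈0 = all
    where
    p = corner L U
    positive : ∀ i → c (suc i) ≈ 0#
    positive i = domain (U i + - L i) (c (suc i)) (nondegenerate i) (begin
      (U i + - L i) * c (suc i)
        ≈⟨ *-comm _ _ ⟩
      c (suc i) * (U i + - L i)
        ≡⟨ ≡.cong (λ z → c (suc i) * (z + - L i)) (Vector.updateAt-updates i L) ⟨
      t (suc i)
        ≈⟨ +-identityʳ _ ⟨
      t (suc i) + 0#
        ≈⟨ +-congˡ (sum-zero others) ⟨
      t (suc i) + sum (Vector.removeAt t (suc i))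
        ≈⟨ sum-remove {i = suc i} t ⟨
      sum t
        ≈⟨ sum-cong-≋ (λ j → distribˡ (c j) (p j i) (- L i)) ⟩
      sum (λ j → c j * p j i + c j * (- L i))
        ≈⟨ ∑-distrib-+ (λ j → c j * p j i) (λ j → c j * (- L i)) ⟩
      sum (λ j → c j * p j i) + sum (λ j → c j * (- L i))
        ≈⟨ +-cong (∑cp≈0 i) (sym (*-distribʳ-sum (- L i) c)) ⟩
      0# + sum c * (- L i)
        ≈⟨ trans (+-identityˡ _) (trans (*-congʳ ∑c≈0) (zeroˡ _)) ⟩
      0# ∎)
      where
      t : Vector Carrier (suc d)
      t j = c j * (p j i + - L i)
      atL : ∀ j → j ≢ suc i → p j i ≡ L i
      atL zero    j≢ = ≡.refl
      atL (suc j) j≢ = Vector.updateAt-minimal i j L (λ i≡j → j≢ (≡.cong suc (≡.sym i≡j)))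
      others : ∀ l → t (punchIn (suc i) l) ≈ 0#
      others l = trans
        (*-congˡ (trans (+-congʳ (reflexive (atL (punchIn (suc i) l) (Fin.punchInᵢ≢i (suc i) l)))) (-‿inverseʳ (L i))))
        (zeroʳ _)
    all : ∀ j → c j ≈ 0#
    all (suc i) = positive i
    all zero    = begin
      c zero                          ≈⟨ +-identityʳ _ ⟨
      c zero + 0#                     ≈⟨ +-congˡ (sum-zero positive) ⟨
      c zero + sum (λ i → c (suc i))  ≈⟨ ∑c≈0 ⟩
      0#                              ∎

  tail-independent : ∀ {d m} (p : Vector (Vector Carrier d) (suc m)) → Independent p → Independent (Vector.tail p)
  tail-independent p independent c ∑c≈0 ∑cp≈0 j = independent (0# Vector.∷ c)
    (trans (+-identityˡ _) ∑c≈0) (λ i → trans (+-cong (zeroˡ _) (∑cp≈0 i)) (+-identityˡ _)) (suc j)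

  Contains : ∀ {d} → ℕ → Pred (Vector Carrier d) c → Set _
  Contains {d} m S = ∃[ p ] ((∀ j → S (p j)) × Independent {d} {m} p)

  contains-tail : ∀ {d m} {S : Pred (Vector Carrier d) c} → Contains (suc m) S → Contains m S
  contains-tail (p , p∈S , independent) = Vector.tail p , p∈S ∘ suc , tail-independent p independent

  contains-≤ : ∀ {d m n} {S : Pred (Vector Carrier d) c} → m ℕ.≤ n → Contains n S → Contains m S
  contains-≤ {m = m} {n} {S} m≤n with ℕ.m≤n⇒∃[o]m+o≡n m≤n
  ... | o , ≡.refl = go o
    where
    go : ∀ o → Contains (m ℕ.+ o) S → Contains m S
    go zero    = ≡.subst (λ n → Contains n S) (ℕ.+-identityʳ m)
    go (suc o) = go o ∘ contains-tail {S = S} ∘ ≡.subst (λ n → Contains n S) (ℕ.+-suc m o)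

  box-contains : ∀ {d} {S : Pred (Vector Carrier d) c} (L U : Vector Carrier d) →
    (∀ i → ¬ U i + - L i ≈ 0#) → (∀ x → (∀ i → x i ≡ L i ⊎ x i ≡ U i) → S x) → Contains (suc d) S
  box-contains {d} {S} L U nondegenerate corners∈S = corner L U , member , corner-independent L U nondegenerate
    where
    member : ∀ j → S (corner L U j)
    member zero    = corners∈S L (λ i → inj₁ ≡.refl)
    member (suc j) = corners∈S (corner L U (suc j)) side
      where
      side : ∀ i → corner L U (suc j) i ≡ L i ⊎ corner L U (suc j) i ≡ U i
      side i with i Fin.≟ j
      ... | yes ≡.refl = inj₂ (Vector.updateAt-updates i L)
      ... | no  i≢j    = inj₁ (Vector.updateAt-minimal i j L i≢j)

  flat-¬contains : ∀ {d m} {S : Pred (Vector Carrier d) c} (free : List (Fin d)) →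
    (∀ i → i ∈ free ⊎ (∀ x y → S x → S y → x i ≈ y i)) → length free < m → ¬ Contains (suc m) S
  flat-¬contains free fixed len<m (p , p∈S , independent) =
    dependent p free (p zero)
      (λ i → Sum.map₂ (λ eq j → eq (p j) (p zero) (p∈S j) (p∈S zero)) (fixed i)) (s≤s len<m) independent

open import Algebra.Properties.Semiring.Sum ℕ.+-*-semiring
  using (sum; sum-cong-≗; sum-replicate-zero; ∑-distrib-+; *-distribˡ-sum)
open import Algebra.Structures using (IsCommutativeRing)
open import Data.Bool.Base using (Bool; true; false; not; _∧_; _∨_; _xor_)
open import Data.Bool.Properties using (T-≡)
open import Data.Empty using (⊥)
open import Data.Fin.Subset using (Subset; inside; outside; ∣_∣; ∁)
open import Data.Fin.Subset.Properties using (∣∁p∣≡n∸∣p∣; ∣p∣≤n)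
import Data.Integer.Base as ℤ
import Data.Integer.Properties as ℤ
open import Data.Maybe.Base using (Maybe; just; nothing)
open import Data.Nat.Base using (ℕ; suc; _+_; _*_; _∸_; _^_; _/_; _≤_; _<_; _≤ᵇ_; _<ᵇ_; ⌊_/2⌋; parity)
open import Data.Nat.Combinatorics using (_C_; nCk+nC[k+1]≡[n+1]C[k+1])
open import Data.Nat.Divisibility using (_∣_; divides)
open import Data.Nat.DivMod using (m*n/n≡m)
import Data.Nat.ListAction as ListAction
import Data.Nat.ListAction.Properties as ListAction
open import Data.Nat.Properties
open import Data.Nat.Tactic.RingSolver using (solve-∀)
open import Data.Parity.Base using (Parity; 0ℙ; 1ℙ)
open import Data.Rational.Base as ℚ using (ℚ; 0ℚ; 1ℚ; toℚᵘ; _⊔_)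
import Data.Rational.Properties as ℚ
import Data.Rational.Solver as ℚ
open import Data.Rational.Unnormalised.Base as ℚᵘ using (mkℚᵘ; *≡*; *≤*)
import Data.Rational.Unnormalised.Properties as ℚᵘ
open import Data.Vec.Base using (Vec; []; _∷_; lookup; tabulate; updateAt)
import Defs as ℝ
open import Defs using (n[_,_]≤_; fromℕ; ∣B∣; binomialSum; sumFromTo; 1/2^; B?; configuration?;
  binaryVectors; ℝ; 0ℝ; seq; cauchy; _≈_; ℝ^; AffinelyIndependent; ContainsIndependent;
  Box; ⟦_⟧; lower; upper; lower≤upper; IsNeighborly)
open import Function.Bundles using (Equivalence)
open import Relation.Binary.PropositionalEquality

-- Sums over the cube

𝟙 : Bool → ℕ
𝟙 true  = 1
𝟙 false = 0

∑□ : ∀ {n} → (Subset n → ℕ) → ℕ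
∑□ {zero}  f = f []
∑□ {suc n} f = ∑□ (f ∘ (outside ∷_)) + ∑□ (f ∘ (inside ∷_))

count : ∀ {n} → (Subset n → Bool) → ℕ
count F = ∑□ (𝟙 ∘ F)

∑□-cong : ∀ {n} {f g : Subset n → ℕ} → (∀ v → f v ≡ g v) → ∑□ f ≡ ∑□ g
∑□-cong {zero}  f≗g = f≗g []
∑□-cong {suc n} f≗g = cong₂ _+_ (∑□-cong (f≗g ∘ (outside ∷_))) (∑□-cong (f≗g ∘ (inside ∷_)))

∑□-mono : ∀ {n} {f g : Subset n → ℕ} → (∀ v → f v ≤ g v) → ∑□ f ≤ ∑□ g
∑□-mono {zero}  f≤g = f≤g []
∑□-mono {suc n} f≤g = +-mono-≤ (∑□-mono (f≤g ∘ (outside ∷_))) (∑□-mono (f≤g ∘ (inside ∷_)))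

interchange : ∀ a b c d → (a + b) + (c + d) ≡ (a + c) + (b + d)
interchange = solve-∀

∑□-+ : ∀ {n} (f g : Subset n → ℕ) → ∑□ (λ v → f v + g v) ≡ ∑□ f + ∑□ g
∑□-+ {zero}  f g = refl
∑□-+ {suc n} f g = trans
  (cong₂ _+_ (∑□-+ (f ∘ (outside ∷_)) (g ∘ (outside ∷_))) (∑□-+ (f ∘ (inside ∷_)) (g ∘ (inside ∷_))))
  (interchange (∑□ (f ∘ (outside ∷_))) _ _ _)

∑□-const : ∀ {n} c → ∑□ {n} (λ _ → c) ≡ 2 ^ n * c
∑□-const {zero}  c = sym (+-identityʳ c)
∑□-const {suc n} c = trans (cong₂ _+_ (∑□-const {n} c) (∑□-const {n} c)) (double (2 ^ n) c)
  where
  double : ∀ a c → a * c + a * c ≡ 2 * a * c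
  double = solve-∀

∑□-∁ : ∀ {n} (f : Subset n → ℕ) → ∑□ (f ∘ ∁) ≡ ∑□ f
∑□-∁ {zero}  f = refl
∑□-∁ {suc n} f = trans
  (cong₂ _+_ (∑□-∁ (f ∘ (inside ∷_))) (∑□-∁ (f ∘ (outside ∷_))))
  (+-comm (∑□ (f ∘ (inside ∷_))) _)

-- Neither half of the cube can make up for a deficit in the other. This turns an equality of counts
-- into a pointwise statement, from which a family is seen to be compressed.
∑□-squeeze : ∀ {n} {f g : Subset n → ℕ} → (∀ v → f v ≤ g v) → ∑□ g ≤ ∑□ f → ∀ v → g v ≤ f v
∑□-squeeze {zero}          f≤g ∑g≤∑f []            = ∑g≤∑f
∑□-squeeze {suc n} {f} {g} f≤g ∑g≤∑f (outside ∷ v) = ∑□-squeeze (f≤g ∘ (outside ∷_))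
  (+-cancelʳ-≤ (∑□ (f ∘ (inside ∷_))) _ _
    (≤-trans (+-monoʳ-≤ (∑□ (g ∘ (outside ∷_))) (∑□-mono (f≤g ∘ (inside ∷_)))) ∑g≤∑f)) v
∑□-squeeze {suc n} {f} {g} f≤g ∑g≤∑f (inside ∷ v) = ∑□-squeeze (f≤g ∘ (inside ∷_))
  (+-cancelˡ-≤ (∑□ (f ∘ (outside ∷_))) _ _
    (≤-trans (+-monoˡ-≤ (∑□ (g ∘ (inside ∷_))) (∑□-mono (f≤g ∘ (outside ∷_)))) ∑g≤∑f)) v

hamming : ∀ {n} → Subset n → Subset n → ℕ
hamming []      []      = 0
hamming (a ∷ u) (b ∷ v) = 𝟙 (a xor b) + hamming u v

xor-comm : ∀ a b → a xor b ≡ b xor a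
xor-comm true  true  = refl
xor-comm true  false = refl
xor-comm false true  = refl
xor-comm false false = refl

hamming-sym : ∀ {n} (u v : Subset n) → hamming u v ≡ hamming v u
hamming-sym []      []      = refl
hamming-sym (a ∷ u) (b ∷ v) = cong₂ _+_ (cong 𝟙 (xor-comm a b)) (hamming-sym u v)

hamming-∁ : ∀ {n} (v : Subset n) → hamming v (∁ v) ≡ n
hamming-∁ []          = refl
hamming-∁ (true  ∷ v) = cong suc (hamming-∁ v)
hamming-∁ (false ∷ v) = cong suc (hamming-∁ v)

agreement : ∀ {n} (u v : Subset n) → hamming u v < n → ∃[ i ] lookup u i ≡ lookup v i
agreement (true  ∷ u) (true  ∷ v) _       = zero , refl
agreement (false ∷ u) (false ∷ v) _       = zero , refl
agreement (true  ∷ u) (false ∷ v) (s≤s p) = let i , eq = agreement u v p in suc i , eq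
agreement (false ∷ u) (true  ∷ v) (s≤s p) = let i , eq = agreement u v p in suc i , eq

flip : ∀ {n} → Fin n → Subset n → Subset n
flip i v = updateAt v i not

flip-involutive : ∀ {n} i (v : Subset n) → flip i (flip i v) ≡ v
flip-involutive zero    (true  ∷ v) = refl
flip-involutive zero    (false ∷ v) = refl
flip-involutive (suc i) (a     ∷ v) = cong (a ∷_) (flip-involutive i v)

∑□-flip : ∀ {n} i (f : Subset n → ℕ) → ∑□ (f ∘ flip i) ≡ ∑□ f
∑□-flip zero    f = +-comm (∑□ (f ∘ (inside ∷_))) _
∑□-flip (suc i) f = cong₂ _+_ (∑□-flip i (f ∘ (outside ∷_))) (∑□-flip i (f ∘ (inside ∷_)))

hamming-flip₂ : ∀ {n} i (u v : Subset n) → hamming (flip i u) (flip i v) ≡ hamming u v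
hamming-flip₂ zero    (a ∷ u) (b ∷ v) = cong (λ c → 𝟙 c + hamming u v) (not-xor-not a b)
  where
  not-xor-not : ∀ a b → not a xor not b ≡ a xor b
  not-xor-not true  b = refl
  not-xor-not false true  = refl
  not-xor-not false false = refl
hamming-flip₂ (suc i) (a ∷ u) (b ∷ v) = cong (𝟙 (a xor b) +_) (hamming-flip₂ i u v)

hamming-flip-≤ : ∀ {n} i (u v : Subset n) → hamming u v ≤ suc (hamming (flip i u) v)
hamming-flip-≤ zero (a ∷ u) (b ∷ v) = +-monoˡ-≤ (hamming u v) {y = suc (𝟙 (not a xor b))} (𝟙≤1+ (a xor b) _)
  where
  𝟙≤1+ : ∀ c m → 𝟙 c ≤ suc m
  𝟙≤1+ true  m = s≤s z≤n
  𝟙≤1+ false m = z≤n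
hamming-flip-≤ (suc i) (a ∷ u) (b ∷ v) = ≤-trans
  (+-monoʳ-≤ (𝟙 (a xor b)) (hamming-flip-≤ i u v)) (≤-reflexive (+-suc (𝟙 (a xor b)) _))

hamming-flip-agreement : ∀ {n} i (u v : Subset n) → lookup u i ≡ lookup v i →
                         hamming (flip i u) v ≡ suc (hamming u v)
hamming-flip-agreement zero    (true  ∷ u) (true  ∷ v) eq = refl
hamming-flip-agreement zero    (false ∷ u) (false ∷ v) eq = refl
hamming-flip-agreement (suc i) (a     ∷ u) (b     ∷ v) eq = trans
  (cong (𝟙 (a xor b) +_) (hamming-flip-agreement i u v eq)) (+-suc (𝟙 (a xor b)) _)

DiameterAtMost : ∀ {n} → ℕ → (Subset n → Bool) → Set
DiameterAtMost s F = ∀ u v → F u ≡ true → F v ≡ true → hamming u v ≤ s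

-- F is disjoint from the antipodes of G.
count-antipodal : ∀ {n} (F G : Subset n → Bool) →
  (∀ u v → F u ≡ true → G v ≡ true → hamming u v < n) → count F + count G ≤ 2 ^ n
count-antipodal {n} F G close = begin
  count F + count G                    ≡⟨ cong (count F +_) (∑□-∁ (𝟙 ∘ G)) ⟨
  count F + count (G ∘ ∁)              ≡⟨ ∑□-+ (𝟙 ∘ F) (𝟙 ∘ G ∘ ∁) ⟨
  ∑□ (λ v → 𝟙 (F v) + 𝟙 (G (∁ v)))     ≤⟨ ∑□-mono (λ v → atMostOne v (F v) (G (∁ v)) refl refl) ⟩
  ∑□ {n} (λ _ → 1)                     ≡⟨ ∑□-const {n} 1 ⟩
  2 ^ n * 1                            ≡⟨ *-identityʳ _ ⟩
  2 ^ n                                ∎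
  where
  open ≤-Reasoning
  atMostOne : ∀ v a b → F v ≡ a → G (∁ v) ≡ b → 𝟙 a + 𝟙 b ≤ 1
  atMostOne v true  true  Fv Gv = contradiction (hamming-∁ v) (<⇒≢ (close v (∁ v) Fv Gv))
  atMostOne v true  false Fv Gv = s≤s z≤n
  atMostOne v false true  Fv Gv = s≤s z≤n
  atMostOne v false false Fv Gv = z≤n

-- Kleitman's diameter theorem

-- Replaces inside ∷ flip i u by outside ∷ u unless the latter is already present. In a family of
-- diameter at most s on which this has no effect for any i, the members with head inside have
-- diameter at most s - 2: two of them agree in some position i, and flipping both i and the head
-- of one raises their distance by 2.
compress : ∀ {n} → Fin n → (Subset (suc n) → Bool) → Subset (suc n) → Bool
compress i F (outside ∷ u) = F (outside ∷ u) ∨ F (inside ∷ flip i u)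
compress i F (inside  ∷ u) = F (inside ∷ u) ∧ F (outside ∷ flip i u)

top : ∀ {n} → (Subset (suc n) → Bool) → Subset n → Bool
top F u = F (inside ∷ u)

-- Compression acts separately on the pairs formed by `inside ∷ u` and `outside ∷ flip i u`:
-- memberships a and b become their disjunction and conjunction. Flipping the lower half lines these
-- pairs up.
count-compress : ∀ {n} i (F : Subset (suc n) → Bool) → count (compress i F) ≡ count F
count-compress i F = begin
  ∑□ (λ u → 𝟙 (F₀ u ∨ F₁ (flip i u))) + ∑□ (λ u → 𝟙 (F₁ u ∧ F₀ (flip i u)))
    ≡⟨ cong (_+ ∑□ (λ u → 𝟙 (F₁ u ∧ F₀ (flip i u)))) (∑□-flip i _) ⟨
  ∑□ (λ u → 𝟙 (F₀ (flip i u) ∨ F₁ (flip i (flip i u)))) + ∑□ (λ u → 𝟙 (F₁ u ∧ F₀ (flip i u)))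
    ≡⟨ ∑□-+ (λ u → 𝟙 (F₀ (flip i u) ∨ F₁ (flip i (flip i u)))) _ ⟨
  ∑□ (λ u → 𝟙 (F₀ (flip i u) ∨ F₁ (flip i (flip i u))) + 𝟙 (F₁ u ∧ F₀ (flip i u)))
    ≡⟨ ∑□-cong (λ u → trans
         (cong (λ v → 𝟙 (F₀ (flip i u) ∨ F₁ v) + 𝟙 (F₁ u ∧ F₀ (flip i u))) (flip-involutive i u))
         (modular (F₀ (flip i u)) (F₁ u))) ⟩
  ∑□ (λ u → 𝟙 (F₀ (flip i u)) + 𝟙 (F₁ u))
    ≡⟨ ∑□-+ (λ u → 𝟙 (F₀ (flip i u))) (𝟙 ∘ F₁) ⟩
  ∑□ (λ u → 𝟙 (F₀ (flip i u))) + ∑□ (𝟙 ∘ F₁)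
    ≡⟨ cong (_+ ∑□ (𝟙 ∘ F₁)) (∑□-flip i (𝟙 ∘ F₀)) ⟩
  ∑□ (𝟙 ∘ F₀) + ∑□ (𝟙 ∘ F₁) ∎
  where
  open ≡-Reasoning
  F₀ = F ∘ (outside ∷_)
  F₁ = F ∘ (inside ∷_)
  modular : ∀ a b → 𝟙 (a ∨ b) + 𝟙 (b ∧ a) ≡ 𝟙 a + 𝟙 b
  modular true  true  = refl
  modular true  false = refl
  modular false true  = refl
  modular false false = refl

compress-outside : ∀ {n} i (F : Subset (suc n) → Bool) u → compress i F (outside ∷ u) ≡ true →
                   F (outside ∷ u) ≡ true ⊎ F (inside ∷ flip i u) ≡ true
compress-outside i F u eq with F (outside ∷ u)
... | true  = inj₁ refl
... | false = inj₂ eq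

compress-inside : ∀ {n} i (F : Subset (suc n) → Bool) u → compress i F (inside ∷ u) ≡ true →
                  F (inside ∷ u) ≡ true × F (outside ∷ flip i u) ≡ true
compress-inside i F u eq with F (inside ∷ u) | F (outside ∷ flip i u)
... | true | true = refl , refl

-- The critical pair is a moved vertex and one that keeps its head `inside`. The latter stayed
-- because its own shifted copy is in F too, and the distance to that copy is the required one.
-- Between a moved vertex and an unmoved one with head `outside`, the former difference of heads
-- pays for the flip at i.
compress-diameter : ∀ {n s} i {F : Subset (suc n) → Bool} →
                    DiameterAtMost s F → DiameterAtMost s (compress i F)
compress-diameter {s = s} i {F} diam = go
  where
  mixed : ∀ u v → compress i F (outside ∷ u) ≡ true → compress i F (inside ∷ v) ≡ true →
          suc (hamming u v) ≤ s
  mixed u v p q with compress-outside i F u p | compress-inside i F v q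
  ... | inj₁ Fu | Fv , _   = diam _ _ Fu Fv
  ... | inj₂ Fu | _  , Fv′ = subst (λ x → suc x ≤ s) (hamming-flip₂ i u v) (diam _ _ Fu Fv′)
  moved-kept : ∀ u v → F (inside ∷ flip i u) ≡ true → F (outside ∷ v) ≡ true → hamming u v ≤ s
  moved-kept u v Fu Fv = ≤-trans (hamming-flip-≤ i u v) (diam _ _ Fu Fv)
  go : DiameterAtMost s (compress i F)
  go (inside ∷ u) (inside ∷ v) p q =
    diam _ _ (proj₁ (compress-inside i F u p)) (proj₁ (compress-inside i F v q))
  go (outside ∷ u) (inside ∷ v) p q = mixed u v p q
  go (inside ∷ u) (outside ∷ v) p q = subst (λ x → suc x ≤ s) (hamming-sym v u) (mixed v u q p)
  go (outside ∷ u) (outside ∷ v) p q with compress-outside i F u p | compress-outside i F v q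
  ... | inj₁ Fu | inj₁ Fv = diam _ _ Fu Fv
  ... | inj₁ Fu | inj₂ Fv = subst (_≤ s) (hamming-sym v u) (moved-kept v u Fv Fu)
  ... | inj₂ Fu | inj₁ Fv = moved-kept u v Fu Fv
  ... | inj₂ Fu | inj₂ Fv = subst (_≤ s) (hamming-flip₂ i u v) (diam _ _ Fu Fv)

Compressed : ∀ {n} → (Subset (suc n) → Bool) → Set
Compressed F = ∀ i u → F (inside ∷ u) ≡ true → F (outside ∷ flip i u) ≡ true

top-compress-≤ : ∀ {n} i (F : Subset (suc n) → Bool) u → 𝟙 (top (compress i F) u) ≤ 𝟙 (top F u)
top-compress-≤ i F u with F (inside ∷ u) | F (outside ∷ flip i u)
... | true  | true  = s≤s z≤n
... | true  | false = z≤n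
... | false | _     = z≤n

compressed : ∀ {n} (F : Subset (suc n) → Bool) →
  (∀ i → count (top (compress i F)) ≡ count (top F)) → Compressed F
compressed F fixed i u Fu with ∑□-squeeze (top-compress-≤ i F) (≤-reflexive (sym (fixed i))) u
... | le with F (inside ∷ u) | F (outside ∷ flip i u)
... | true | true = refl
compressed F fixed i u refl | () | true | false

-- Compression never enlarges the top, so one that changes the size of the top makes it strictly
-- smaller; c bounds that size and drives the recursion.
compression : ∀ {n s} (F : Subset (suc n) → Bool) → DiameterAtMost s F →
  ∃[ G ] (count G ≡ count F × DiameterAtMost s G × Compressed G)
compression {n} {s} F diam = go (count (top F)) F ≤-refl diam
  where
  go : ∀ c F → count (top F) ≤ c → DiameterAtMost s F →
       ∃[ G ] (count G ≡ count F × DiameterAtMost s G × Compressed G)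
  go c F ≤c diam with Fin.all? (λ i → count (top (compress i F)) ≟ count (top F))
  ... | yes fixed = F , refl , diam , compressed F fixed
  ... | no ¬fixed with Fin.¬∀⟶∃¬ n _ (λ i → count (top (compress i F)) ≟ count (top F)) ¬fixed
  ... | i , moved with c | ≤-trans (≤∧≢⇒< (∑□-mono (top-compress-≤ i F)) moved) ≤c
  ... | suc c′ | s≤s ≤c′ =
    let G , eq , rest = go c′ (compress i F) ≤c′ (compress-diameter i diam)
    in G , trans eq (count-compress i F) , rest

-- Sizes of the configurations and their Pascal recursion

∣conf∣ : Parity → ℕ → ℕ → ℕ
∣conf∣ π t d = ∑□ {d} (λ v → 𝟙 (does (configuration? π t v)))

length-filter-map : ∀ {A B : Set} {P : Pred B 0ℓ} (P? : Decidable P) (f : A → B) xs →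
  length (filter P? (List.map f xs)) ≡ length (filter (P? ∘ f) xs)
length-filter-map P? f List.[] = refl
length-filter-map P? f (x List.∷ xs) with does (P? (f x))
... | true  = cong suc (length-filter-map P? f xs)
... | false = length-filter-map P? f xs

length-filter-binaryVectors : ∀ d {P : Pred (Subset d) 0ℓ} (P? : Decidable P) →
  length (filter P? (binaryVectors d)) ≡ ∑□ (λ v → 𝟙 (does (P? v)))
length-filter-binaryVectors zero P? with does (P? [])
... | true  = refl
... | false = refl
length-filter-binaryVectors (suc d) P? = begin
  length (filter P? (os List.++ (is List.++ List.[])))
    ≡⟨ cong (λ xs → length (filter P? (os List.++ xs))) (List.++-identityʳ is) ⟩
  length (filter P? (os List.++ is))
    ≡⟨ cong length (List.filter-++ P? os is) ⟩
  length (filter P? os List.++ filter P? is)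
    ≡⟨ List.length-++ (filter P? os) ⟩
  length (filter P? os) + length (filter P? is)
    ≡⟨ cong₂ _+_ (part outside) (part inside) ⟩
  ∑□ (λ v → 𝟙 (does (P? v))) ∎
  where
  open ≡-Reasoning
  os = List.map (outside ∷_) (binaryVectors d)
  is = List.map (inside ∷_) (binaryVectors d)
  part : ∀ b → length (filter P? (List.map (b ∷_) (binaryVectors d))) ≡ ∑□ (λ v → 𝟙 (does (P? (b ∷ v))))
  part b = trans (length-filter-map P? (b ∷_) (binaryVectors d))
                 (length-filter-binaryVectors d (P? ∘ (b ∷_)))

∣B∣≡∣conf∣ : ∀ m d → ∣B∣ m d ≡ ∣conf∣ (parity m) ⌊ m /2⌋ d
∣B∣≡∣conf∣ m d = length-filter-binaryVectors d (B? m d)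

<ᵇ-suc : ∀ m n → (m <ᵇ suc n) ≡ (m ≤ᵇ n)
<ᵇ-suc zero    n = refl
<ᵇ-suc (suc m) n = refl

∣conf∣-even-suc : ∀ t d → ∣conf∣ 0ℙ (suc t) (suc d) ≡ ∣conf∣ 0ℙ (suc t) d + ∣conf∣ 0ℙ t d
∣conf∣-even-suc t d = cong (∣conf∣ 0ℙ (suc t) d +_) (∑□-cong {d} (λ v → cong 𝟙 (<ᵇ-suc ∣ v ∣ t)))

-- For odd configurations the free first coordinate stays in place and the second one is split.
-- Length 0 is excluded because the odd configuration is empty there, while at length 1 it is not.
∣conf∣-suc : ∀ π t {d} → 0 < d → ∣conf∣ π (suc t) (suc d) ≡ ∣conf∣ π (suc t) d + ∣conf∣ π t d
∣conf∣-suc 0ℙ t {d}     _ = ∣conf∣-even-suc t d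
∣conf∣-suc 1ℙ t {suc d} _ = trans (cong₂ _+_ (∣conf∣-even-suc t d) (∣conf∣-even-suc t d))
                                  (interchange (∣conf∣ 0ℙ (suc t) d) _ _ _)

∣conf∣-zero : ∀ π {d} → 0 < d → ∣conf∣ π 0 d ≤ ∣conf∣ π 0 (suc d)
∣conf∣-zero 0ℙ         _ = m≤m+n _ _
∣conf∣-zero 1ℙ {suc d} _ = +-mono-≤ (m≤m+n (∣conf∣ 0ℙ 0 d) _) (m≤m+n (∣conf∣ 0ℙ 0 d) _)

∣B∣-suc : ∀ s {d} → 0 < d → ∣B∣ (2 + s) (suc d) ≡ ∣B∣ (2 + s) d + ∣B∣ s d
∣B∣-suc s {d} 0<d
  rewrite ∣B∣≡∣conf∣ (2 + s) (suc d) | ∣B∣≡∣conf∣ (2 + s) d | ∣B∣≡∣conf∣ s d =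
  ∣conf∣-suc (parity s) ⌊ s /2⌋ 0<d

∣B∣-mono : ∀ s {d} → 0 < d → ∣B∣ s d ≤ ∣B∣ s (suc d)
∣B∣-mono zero {d} 0<d
  rewrite ∣B∣≡∣conf∣ 0 (suc d) | ∣B∣≡∣conf∣ 0 d = ∣conf∣-zero 0ℙ 0<d
∣B∣-mono (suc zero) {d} 0<d
  rewrite ∣B∣≡∣conf∣ 1 (suc d) | ∣B∣≡∣conf∣ 1 d = ∣conf∣-zero 1ℙ 0<d
∣B∣-mono (suc (suc s)) 0<d = ≤-trans (m≤m+n _ _) (≤-reflexive (sym (∣B∣-suc s 0<d)))

∣v∣+∣∁v∣ : ∀ {n} (v : Subset n) → ∣ v ∣ + ∣ ∁ v ∣ ≡ n
∣v∣+∣∁v∣ v = trans (cong (∣ v ∣ +_) (∣∁p∣≡n∸∣p∣ v)) (m+[n∸m]≡n (∣p∣≤n v))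

parity-⌊n/2⌋ : ∀ n → (parity n ≡ 0ℙ × n ≡ ⌊ n /2⌋ + ⌊ n /2⌋) ⊎
                     (parity n ≡ 1ℙ × n ≡ suc (⌊ n /2⌋ + ⌊ n /2⌋))
parity-⌊n/2⌋ zero          = inj₁ (refl , refl)
parity-⌊n/2⌋ (suc zero)    = inj₂ (refl , refl)
parity-⌊n/2⌋ (suc (suc n)) with parity-⌊n/2⌋ n
... | inj₁ (p , eq) = inj₁ (p , trans (cong (2 +_) eq) (cong suc (sym (+-suc _ _))))
... | inj₂ (p , eq) = inj₂ (p , trans (cong (2 +_) eq) (cong (2 +_) (sym (+-suc _ _))))

-- The weights of v and its antipode add up to 2 t + 1, so they cannot both exceed t.
half-cover : ∀ t {n} (v : Subset n) → n ≡ suc (t + t) →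
             1 ≤ 𝟙 (does (∣ v ∣ ≤? t)) + 𝟙 (does (∣ ∁ v ∣ ≤? t))
half-cover t v eq with ∣ v ∣ ≤? t
... | yes p rewrite dec-true (∣ v ∣ ≤? t) p = s≤s z≤n
... | no ¬p with ∣ ∁ v ∣ ≤? t
... | yes q rewrite dec-true (∣ ∁ v ∣ ≤? t) q = m≤n+m 1 (𝟙 (does (∣ v ∣ ≤? t)))
... | no ¬q = contradiction
  (≤-trans (+-mono-≤ (≰⇒> ¬p) (≰⇒> ¬q)) (≤-reflexive (trans (∣v∣+∣∁v∣ v) eq)))
  (<⇒≱ (≤-reflexive (sym (cong suc (+-suc t t)))))

-- Up to antipodes the configuration covers the cube. For even n this is a matter of the weights of
-- all n + 1 coordinates, for odd n of the n coordinates after the free one.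
∣B∣-half : ∀ n → 2 ^ suc n ≤ ∣B∣ n (suc n) + ∣B∣ n (suc n)
∣B∣-half n rewrite ∣B∣≡∣conf∣ n (suc n) = begin
  2 ^ suc n                             ≡⟨ *-identityʳ _ ⟨
  2 ^ suc n * 1                         ≡⟨ ∑□-const {suc n} 1 ⟨
  ∑□ {suc n} (λ _ → 1)                  ≤⟨ ∑□-mono cover ⟩
  ∑□ (λ v → conf v + conf (∁ v))        ≡⟨ ∑□-+ conf (conf ∘ ∁) ⟩
  ∑□ conf + ∑□ (conf ∘ ∁)               ≡⟨ cong (∑□ conf +_) (∑□-∁ conf) ⟩
  ∑□ conf + ∑□ conf                     ∎
  where
  open ≤-Reasoning
  conf : Subset (suc n) → ℕ
  conf v = 𝟙 (does (configuration? (parity n) ⌊ n /2⌋ v))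
  cover : ∀ v → 1 ≤ conf v + conf (∁ v)
  cover (b ∷ v) with parity n | parity-⌊n/2⌋ n
  ... | 0ℙ | inj₁ (_ , eq) = half-cover ⌊ n /2⌋ (b ∷ v) (cong suc eq)
  ... | 1ℙ | inj₂ (_ , eq) = half-cover ⌊ n /2⌋ v eq

-- Induction on the dimension: the diameters s and s - 2 of the two halves of a compressed family
-- match the recursion `∣B∣-suc`. The halves need s < n; the remaining case s = n is settled by
-- antipodes, since a family without antipodal pairs fills at most half of the cube.
kleitman : ∀ n s (F : Subset n → Bool) → s < n → DiameterAtMost s F → count F ≤ ∣B∣ s n
kleitman (suc n) s F s<1+n diam with m≤n⇒m<n∨m≡n (s≤s⁻¹ s<1+n)
... | inj₂ refl = half-≤ (≤-trans
  (count-antipodal F F (λ u v p q → s≤s (diam u v p q))) (∣B∣-half s))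
  where
  half-≤ : ∀ {a b} → a + a ≤ b + b → a ≤ b
  half-≤ {a} {b} le with a ≤? b
  ... | yes a≤b = a≤b
  ... | no  a≰b = contradiction (+-mono-< (≰⇒> a≰b) (≰⇒> a≰b)) (≤⇒≯ le)
... | inj₁ s<n with compression F diam
... | G , eq , diamG , comp = subst (_≤ ∣B∣ s (suc n)) eq (bound s s<n diamG)
  where
  inner : ∀ {s} → s < n → DiameterAtMost s G → ∀ u v → top G u ≡ true → top G v ≡ true →
          2 + hamming u v ≤ s
  inner {s} s<n diamG u v p q =
    let i , agree = agreement u v (≤-<-trans (diamG _ _ p q) s<n)
    in subst (λ x → suc x ≤ s) (hamming-flip-agreement i u v agree) (diamG _ _ (comp i u p) q)
  empty : (∀ u → top G u ≢ true) → count (top G) ≤ 0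
  empty ¬G = ≤-trans (∑□-mono (λ u → zero′ (¬G u))) (≤-reflexive (trans (∑□-const {n} 0) (*-zeroʳ (2 ^ n))))
    where
    zero′ : ∀ {b} → b ≢ true → 𝟙 b ≤ 0
    zero′ {true}  ¬t = contradiction refl ¬t
    zero′ {false} ¬t = z≤n
  bottom : Subset n → Bool
  bottom u = G (outside ∷ u)
  bottom≤ : ∀ {s} → s < n → DiameterAtMost s G → count bottom ≤ ∣B∣ s n
  bottom≤ {s} s<n diamG = kleitman n s bottom s<n (λ u v → diamG (outside ∷ u) (outside ∷ v))
  bound : ∀ s → s < n → DiameterAtMost s G → count G ≤ ∣B∣ s (suc n)
  -- For s < 2 a single member of the top, compared with itself in `inner`, is already a
  -- contradiction, so the top is empty.
  bound zero s<n diamG = begin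
    count bottom + count (top G) ≤⟨ +-mono-≤ (bottom≤ s<n diamG)
                                      (empty (λ u p → contradiction (inner s<n diamG u u p p) λ ())) ⟩
    ∣B∣ 0 n + 0                  ≡⟨ +-identityʳ _ ⟩
    ∣B∣ 0 n                      ≤⟨ ∣B∣-mono 0 s<n ⟩
    ∣B∣ 0 (suc n)                ∎
    where open ≤-Reasoning
  bound (suc zero) s<n diamG = begin
    count bottom + count (top G) ≤⟨ +-mono-≤ (bottom≤ s<n diamG)
                                      (empty (λ u p → contradiction (inner s<n diamG u u p p) λ { (s≤s ()) })) ⟩
    ∣B∣ 1 n + 0                  ≡⟨ +-identityʳ _ ⟩
    ∣B∣ 1 n                      ≤⟨ ∣B∣-mono 1 (m<n⇒0<n s<n) ⟩
    ∣B∣ 1 (suc n)                ∎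
    where open ≤-Reasoning
  bound (suc (suc s)) s<n diamG = begin
    count bottom + count (top G)       ≤⟨ +-mono-≤ (bottom≤ s<n diamG) (kleitman n s (top G) (≤-trans (s≤s (m≤n+m s 2)) s<n)
                                            (λ u v p q → s≤s⁻¹ (s≤s⁻¹ (inner s<n diamG u v p q)))) ⟩
    ∣B∣ (2 + s) n + ∣B∣ s n            ≡⟨ ∣B∣-suc s (m<n⇒0<n s<n) ⟨
    ∣B∣ (2 + s) (suc n)                ∎
    where open ≤-Reasoning

-- Families of words

sum-mono : ∀ {n} {f g : Vector ℕ n} → (∀ a → f a ≤ g a) → sum f ≤ sum g
sum-mono {zero}  f≤g = z≤n
sum-mono {suc n} f≤g = +-mono-≤ (f≤g zero) (sum-mono (f≤g ∘ suc))

sum-1 : ∀ n → sum {n} (λ _ → 1) ≡ n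
sum-1 zero    = refl
sum-1 (suc n) = cong suc (sum-1 n)

∑□-sum : ∀ {n N} (f : Fin N → Subset n → ℕ) → ∑□ (λ v → sum (λ a → f a v)) ≡ sum (λ a → ∑□ (f a))
∑□-sum {n} {zero}  f = trans (∑□-const {n} 0) (*-zeroʳ (2 ^ n))
∑□-sum {n} {suc N} f = trans (∑□-+ (f zero) _) (cong (∑□ (f zero) +_) (∑□-sum (f ∘ suc)))

≤∑□ : ∀ {n} (f : Subset n → ℕ) v → f v ≤ ∑□ f
≤∑□ f []            = ≤-refl
≤∑□ f (outside ∷ v) = m≤n⇒m≤n+o _ (≤∑□ (f ∘ (outside ∷_)) v)
≤∑□ f (inside  ∷ v) = m≤n⇒m≤o+n _ (≤∑□ (f ∘ (inside ∷_)) v)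

𝟙≤1 : ∀ b → 𝟙 b ≤ 1
𝟙≤1 true  = s≤s z≤n
𝟙≤1 false = z≤n

count≤2^n : ∀ {n} (F : Subset n → Bool) → count F ≤ 2 ^ n
count≤2^n {n} F = ≤-trans (∑□-mono (𝟙≤1 ∘ F)) (≤-reflexive (trans (∑□-const {n} 1) (*-identityʳ _)))

AtMostOne : ∀ {N} → (Fin N → Bool) → Set
AtMostOne p = ∀ a b → p a ≡ true → p b ≡ true → a ≡ b

sum-atMostOne : ∀ {N} {p : Fin N → Bool} → AtMostOne p → sum (𝟙 ∘ p) ≤ 1
sum-atMostOne {zero}      unique = z≤n
sum-atMostOne {suc N} {p} unique with p zero in p₀
... | false = sum-atMostOne (λ a b pa pb → Fin.suc-injective (unique (suc a) (suc b) pa pb))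
... | true  = s≤s (≤-trans (sum-mono none) (≤-reflexive (sum-replicate-zero N)))
  where
  none : ∀ a → 𝟙 (p (suc a)) ≤ 0
  none a with p (suc a) in pa
  ... | false = z≤n
  ... | true with () ← unique zero (suc a) p₀ pa

some : ∀ {N} → (Fin N → Bool) → Bool
some p = 0 <ᵇ sum (𝟙 ∘ p)

some⇒∃ : ∀ {N} (p : Fin N → Bool) → some p ≡ true → ∃[ a ] p a ≡ true
some⇒∃ {suc N} p eq with p zero in p₀
... | true  = zero , p₀
... | false = let a , pa = some⇒∃ (p ∘ suc) eq in suc a , pa

𝟙-some : ∀ {N} {p : Fin N → Bool} → AtMostOne p → 𝟙 (some p) ≡ sum (𝟙 ∘ p)
𝟙-some {p = p} unique with sum (𝟙 ∘ p) | sum-atMostOne unique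
... | 0 | _ = refl
... | 1 | _ = refl
... | suc (suc _) | s≤s ()

∧-true : ∀ a {b} → a ∧ b ≡ true → a ≡ true × b ≡ true
∧-true true eq = refl , eq

xor-self : ∀ b → b xor b ≡ false
xor-self true  = refl
xor-self false = refl

xnor : ∀ a b → not (a xor b) ≡ true → a ≡ b
xnor true  true  _ = refl
xnor false false _ = refl

-- nothing is the joker, so that a word stands for a face of the cube.
Word : ℕ → Set
Word = Vec (Maybe Bool)

stars : ∀ {d} → Word d → ℕ
stars []            = 0
stars (nothing ∷ w) = suc (stars w)
stars (just _  ∷ w) = stars w

stars≤d : ∀ {d} (w : Word d) → stars w ≤ d
stars≤d []            = z≤n
stars≤d (nothing ∷ w) = s≤s (stars≤d w)
stars≤d (just _  ∷ w) = m≤n⇒m≤1+n (stars≤d w)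

matches : ∀ {d} → Word d → Subset d → Bool
matches []            []      = true
matches (nothing ∷ w) (_ ∷ v) = matches w v
matches (just a  ∷ w) (b ∷ v) = not (a xor b) ∧ matches w v

conflict : Maybe Bool → Maybe Bool → Bool
conflict (just a) (just b) = a xor b
conflict (just a) nothing  = false
conflict nothing  _        = false

dist : ∀ {d} → Word d → Word d → ℕ
dist []      []       = 0
dist (x ∷ w) (y ∷ w′) = 𝟙 (conflict x y) + dist w w′

count-false : ∀ n → count {n} (λ _ → false) ≡ 0
count-false n = trans (∑□-const {n} 0) (*-zeroʳ (2 ^ n))

count-matches : ∀ {d} (w : Word d) → count (matches w) ≡ 2 ^ stars w
count-matches []                = refl
count-matches (nothing    ∷ w)  = trans (cong₂ _+_ (count-matches w) (count-matches w))
                                        (cong (2 ^ stars w +_) (sym (+-identityʳ _)))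
count-matches {suc d} (just true  ∷ w) = cong₂ _+_ (count-false d) (count-matches w)
count-matches {suc d} (just false ∷ w) = trans (cong₂ _+_ (count-matches w) (count-false d)) (+-identityʳ _)

dist-common : ∀ {d} (w w′ : Word d) u → matches w u ≡ true → matches w′ u ≡ true → dist w w′ ≡ 0
dist-common []      []       []      p q = refl
dist-common (x ∷ w) (y ∷ w′) (b ∷ u) p q = cong₂ _+_ (head x y p q) (dist-common w w′ u (tail x w p) (tail y w′ q))
  where
  tail : ∀ x w → matches (x ∷ w) (b ∷ u) ≡ true → matches w u ≡ true
  tail nothing  w p = p
  tail (just a) w p = proj₂ (∧-true (not (a xor b)) p)
  head : ∀ x y → matches (x ∷ w) (b ∷ u) ≡ true → matches (y ∷ w′) (b ∷ u) ≡ true → 𝟙 (conflict x y) ≡ 0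
  head nothing  y        p q = refl
  head (just _) nothing  p q = refl
  head (just a) (just c) p q = cong 𝟙 (trans
    (cong₂ _xor_ (xnor a b (proj₁ (∧-true (not (a xor b)) p))) (xnor c b (proj₁ (∧-true (not (c xor b)) q))))
    (xor-self b))

hamming-matches : ∀ {d} (w w′ : Word d) u v → matches w u ≡ true → matches w′ v ≡ true →
                  hamming u v ≤ dist w w′ + (stars w + stars w′)
hamming-matches []            []             []      []      p q = z≤n
hamming-matches (nothing ∷ w) (nothing ∷ w′) (b ∷ u) (c ∷ v) p q = begin
  𝟙 (b xor c) + hamming u v                   ≤⟨ +-mono-≤ (𝟙≤1 (b xor c)) (hamming-matches w w′ u v p q) ⟩
  1 + (dist w w′ + (stars w + stars w′))      ≤⟨ n≤1+n _ ⟩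
  2 + (dist w w′ + (stars w + stars w′))      ≡⟨ shift (dist w w′) (stars w) (stars w′) ⟩
  dist w w′ + (suc (stars w) + suc (stars w′)) ∎
  where
  open ≤-Reasoning
  shift : ∀ a b c → 2 + (a + (b + c)) ≡ a + (suc b + suc c)
  shift = solve-∀
hamming-matches (nothing ∷ w) (just a ∷ w′) (b ∷ u) (c ∷ v) p q = begin
  𝟙 (b xor c) + hamming u v                   ≤⟨ +-mono-≤ (𝟙≤1 (b xor c))
                                                   (hamming-matches w w′ u v p (proj₂ (∧-true (not (a xor c)) q))) ⟩
  1 + (dist w w′ + (stars w + stars w′))      ≡⟨ +-suc (dist w w′) _ ⟨
  dist w w′ + (suc (stars w) + stars w′)      ∎
  where open ≤-Reasoning
hamming-matches (just a ∷ w) (nothing ∷ w′) (b ∷ u) (c ∷ v) p q = begin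
  𝟙 (b xor c) + hamming u v                   ≤⟨ +-mono-≤ (𝟙≤1 (b xor c))
                                                   (hamming-matches w w′ u v (proj₂ (∧-true (not (a xor b)) p)) q) ⟩
  1 + (dist w w′ + (stars w + stars w′))      ≡⟨ shift (dist w w′) (stars w) (stars w′) ⟩
  dist w w′ + (stars w + suc (stars w′))      ∎
  where
  open ≤-Reasoning
  shift : ∀ a b c → 1 + (a + (b + c)) ≡ a + (b + suc c)
  shift = solve-∀
hamming-matches (just a ∷ w) (just a′ ∷ w′) (b ∷ u) (c ∷ v) p q = begin
  𝟙 (b xor c) + hamming u v
    ≤⟨ +-mono-≤ (≤-reflexive (cong 𝟙 (cong₂ _xor_ (sym (xnor a b p₁)) (sym (xnor a′ c q₁)))))
                (hamming-matches w w′ u v p₂ q₂) ⟩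
  𝟙 (a xor a′) + (dist w w′ + (stars w + stars w′))
    ≡⟨ +-assoc (𝟙 (a xor a′)) (dist w w′) _ ⟨
  (𝟙 (a xor a′) + dist w w′) + (stars w + stars w′) ∎
  where
  open ≤-Reasoning
  p₁ = proj₁ (∧-true (not (a xor b)) p)
  p₂ = proj₂ (∧-true (not (a xor b)) p)
  q₁ = proj₁ (∧-true (not (a′ xor c)) q)
  q₂ = proj₂ (∧-true (not (a′ xor c)) q)

-- Vertices close to a face

faceDist : ∀ {d} → Word d → Subset d → ℕ
faceDist []            []      = 0
faceDist (nothing ∷ w) (_ ∷ v) = faceDist w v
faceDist (just a  ∷ w) (b ∷ v) = 𝟙 (a xor b) + faceDist w v

-- The free positions of w copy the letters of c, so that only conflicts add to the distance from
-- the face of c. The value `outside` at common stars is an arbitrary choice.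
nearest : ∀ {d} → Word d → Word d → Subset d
nearest []            []             = []
nearest (_       ∷ c) (just b  ∷ w) = b ∷ nearest c w
nearest (just a  ∷ c) (nothing ∷ w) = a ∷ nearest c w
nearest (nothing ∷ c) (nothing ∷ w) = outside ∷ nearest c w

matches-nearest : ∀ {d} (c w : Word d) → matches w (nearest c w) ≡ true
matches-nearest []            []             = refl
matches-nearest (_       ∷ c) (just b  ∷ w) rewrite xor-self b = matches-nearest c w
matches-nearest (just a  ∷ c) (nothing ∷ w) = matches-nearest c w
matches-nearest (nothing ∷ c) (nothing ∷ w) = matches-nearest c w

faceDist-nearest : ∀ {d} (c w : Word d) → faceDist c (nearest c w) ≡ dist c w
faceDist-nearest []            []             = refl
faceDist-nearest (just a  ∷ c) (just b  ∷ w) = cong (𝟙 (a xor b) +_) (faceDist-nearest c w)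
faceDist-nearest (nothing ∷ c) (just b  ∷ w) = faceDist-nearest c w
faceDist-nearest (just a  ∷ c) (nothing ∷ w) rewrite xor-self a = faceDist-nearest c w
faceDist-nearest (nothing ∷ c) (nothing ∷ w) = faceDist-nearest c w

dist-self : ∀ {d} (w : Word d) → dist w w ≡ 0
dist-self []            = refl
dist-self (nothing ∷ w) = dist-self w
dist-self (just a  ∷ w) rewrite xor-self a = dist-self w

binomialSum-suc : ∀ n k → binomialSum n (suc k) ≡ binomialSum n k + n C suc k
binomialSum-suc n k = begin
  ListAction.sum (List.map (n C_) (List.upTo (2 + k)))                    ≡⟨ cong (ListAction.sum ∘ List.map (n C_)) (List.upTo-∷ʳ (suc k)) ⟨
  ListAction.sum (List.map (n C_) (List.upTo (suc k) List.∷ʳ suc k))      ≡⟨ cong ListAction.sum (List.map-++ (n C_) (List.upTo (suc k)) _) ⟩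
  ListAction.sum (List.map (n C_) (List.upTo (suc k)) List.∷ʳ (n C suc k)) ≡⟨ ListAction.sum-++ (List.map (n C_) (List.upTo (suc k))) _ ⟩
  binomialSum n k + (n C suc k + 0)                                 ≡⟨ cong (binomialSum n k +_) (+-identityʳ _) ⟩
  binomialSum n k + n C suc k                                       ∎
  where open ≡-Reasoning

1≤binomialSum : ∀ n k → 1 ≤ binomialSum n k
1≤binomialSum n k = s≤s z≤n

binomialSum-pascal : ∀ n k → binomialSum (suc n) (suc k) ≡ binomialSum n (suc k) + binomialSum n k
binomialSum-pascal n zero = begin
  binomialSum (suc n) 1       ≡⟨ binomialSum-suc (suc n) 0 ⟩
  1 + suc n C 1               ≡⟨ cong (1 +_) (nCk+nC[k+1]≡[n+1]C[k+1] n 0) ⟨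
  1 + (1 + n C 1)             ≡⟨ +-comm 1 _ ⟩
  1 + n C 1 + 1               ≡⟨ cong (_+ 1) (binomialSum-suc n 0) ⟨
  binomialSum n 1 + 1         ∎
  where open ≡-Reasoning
binomialSum-pascal n (suc k) = begin
  binomialSum (suc n) (2 + k)
    ≡⟨ binomialSum-suc (suc n) (suc k) ⟩
  binomialSum (suc n) (suc k) + suc n C (2 + k)
    ≡⟨ cong₂ _+_ (binomialSum-pascal n k) (sym (nCk+nC[k+1]≡[n+1]C[k+1] n (suc k))) ⟩
  (binomialSum n (suc k) + binomialSum n k) + (n C suc k + n C (2 + k))
    ≡⟨ regroup (binomialSum n (suc k)) (binomialSum n k) (n C suc k) (n C (2 + k)) ⟩
  (binomialSum n (suc k) + n C (2 + k)) + (binomialSum n k + n C suc k)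
    ≡⟨ cong₂ _+_ (binomialSum-suc n (suc k)) (binomialSum-suc n k) ⟨
  binomialSum n (2 + k) + binomialSum n (suc k) ∎
  where
  open ≡-Reasoning
  regroup : ∀ a b c d → (a + b) + (c + d) ≡ (a + d) + (b + c)
  regroup = solve-∀

ball : ∀ {d} → Word d → ℕ → Subset d → Bool
ball w k v = faceDist w v ≤ᵇ k

-- One value of the first coordinate agrees with the letter, the other uses up one unit of the
-- radius; the strict comparison with k stands for radius k - 1 and is empty for k = 0.
count-ball-just : ∀ {d} a (w : Word d) k → count (ball (just a ∷ w) k) ≡
                  count (ball w k) + ∑□ (λ v → 𝟙 (faceDist w v <ᵇ k))
count-ball-just true  w k = +-comm (∑□ (λ v → 𝟙 (faceDist w v <ᵇ k))) _
count-ball-just false w k = refl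

-- A star doubles both sides and uses up one unit of h; a letter is Pascal's rule in `d ∸ h`. A word
-- with fewer than h stars arrives at h equal to its length, where the bound is at least the size of
-- the whole cube.
count-ball : ∀ {d} (w : Word d) h k → stars w ≤ h → h ≤ d →
             count (ball w k) ≤ 2 ^ h * binomialSum (d ∸ h) k
count-ball []            zero    k _       _       = ≤-trans (1≤binomialSum 0 k) (≤-reflexive (sym (*-identityˡ _)))
count-ball (nothing ∷ w) (suc h) k (s≤s s) (s≤s l) = ≤-trans
  (+-mono-≤ (count-ball w h k s l) (count-ball w h k s l)) (≤-reflexive (double (2 ^ h) _))
  where
  double : ∀ a c → a * c + a * c ≡ 2 * a * c
  double = solve-∀
count-ball {suc d} (just a ∷ w) h k s l with m≤n⇒m<n∨m≡n l
... | inj₂ refl = ≤-trans (count≤2^n (ball (just a ∷ w) k))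
  (≤-trans (≤-reflexive (sym (*-identityʳ _))) (*-monoʳ-≤ (2 ^ suc d) (1≤binomialSum (d ∸ d) k)))
... | inj₁ (s≤s h≤d) rewrite count-ball-just a w k | +-∸-assoc 1 h≤d = step k
  where
  open ≤-Reasoning
  step : ∀ k → count (ball w k) + ∑□ (λ v → 𝟙 (faceDist w v <ᵇ k)) ≤ 2 ^ h * binomialSum (suc (d ∸ h)) k
  step zero    = begin
    count (ball w 0) + ∑□ (λ v → 𝟙 (faceDist w v <ᵇ 0))  ≡⟨ cong (count (ball w 0) +_) (count-false d) ⟩
    count (ball w 0) + 0                             ≡⟨ +-identityʳ _ ⟩
    count (ball w 0)                                 ≤⟨ count-ball w h 0 s h≤d ⟩
    2 ^ h * binomialSum (d ∸ h) 0                    ∎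
  step (suc k) = begin
    count (ball w (suc k)) + ∑□ (λ v → 𝟙 (faceDist w v <ᵇ suc k))
      ≡⟨ cong (count (ball w (suc k)) +_) (∑□-cong (λ v → cong 𝟙 (<ᵇ-suc (faceDist w v) k))) ⟩
    count (ball w (suc k)) + count (ball w k)
      ≤⟨ +-mono-≤ (count-ball w h (suc k) s h≤d) (count-ball w h k s h≤d) ⟩
    2 ^ h * binomialSum (d ∸ h) (suc k) + 2 ^ h * binomialSum (d ∸ h) k
      ≡⟨ *-distribˡ-+ (2 ^ h) _ _ ⟨
    2 ^ h * (binomialSum (d ∸ h) (suc k) + binomialSum (d ∸ h) k)
      ≡⟨ cong (2 ^ h *_) (binomialSum-pascal (d ∸ h) k) ⟨
    2 ^ h * binomialSum (suc (d ∸ h)) (suc k) ∎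

-- Volumes of neighborly families of words

record NeighborlyWords (k : ℕ) {d N : ℕ} (W : Vector (Word d) N) : Set where
  field
    disjoint : ∀ a b → a ≢ b → 1 ≤ dist (W a) (W b)
    close    : ∀ a b → a ≢ b → dist (W a) (W b) ≤ k

≤ᵇ-true : ∀ {m n} → m ≤ n → (m ≤ᵇ n) ≡ true
≤ᵇ-true = Equivalence.to T-≡ ∘ ≤⇒≤ᵇ

true-≤ᵇ : ∀ m n → (m ≤ᵇ n) ≡ true → m ≤ n
true-≤ᵇ m n = ≤ᵇ⇒≤ m n ∘ Equivalence.from T-≡

𝟙-∧ : ∀ a b → 𝟙 (a ∧ b) ≡ 𝟙 a * 𝟙 b
𝟙-∧ true  b = sym (+-identityʳ _)
𝟙-∧ false b = refl

module _ {k d N} {W : Vector (Word d) N} (nb : NeighborlyWords k W) where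

  open NeighborlyWords nb

  dist≤k : ∀ a b → dist (W a) (W b) ≤ k
  dist≤k a b with a Fin.≟ b
  ... | yes refl = ≤-trans (≤-reflexive (dist-self (W a))) z≤n
  ... | no  a≢b  = close a b a≢b

  matches-unique : ∀ v a b → matches (W a) v ≡ true → matches (W b) v ≡ true → a ≡ b
  matches-unique v a b p q with a Fin.≟ b
  ... | yes a≡b = a≡b
  ... | no  a≢b = contradiction (subst (1 ≤_) (dist-common (W a) (W b) v p q) (disjoint a b a≢b)) λ ()

  -- Injectivity of the nearest vertex takes the form of a double count of pairs of a word b and a
  -- vertex v of its face within distance k of the face of `W a`: each b has at least one such v,
  -- and each v at most one b.
  size-fewStars : ∀ a h → stars (W a) ≤ h → h ≤ d → N ≤ 2 ^ h * binomialSum (d ∸ h) k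
  size-fewStars a h few h≤d = begin
    N                                                        ≡⟨ sum-1 N ⟨
    sum {N} (λ _ → 1)                                        ≤⟨ sum-mono represented ⟩
    sum (λ b → count (λ v → matches (W b) v ∧ ball (W a) k v)) ≡⟨ ∑□-sum (λ b v → 𝟙 (matches (W b) v ∧ ball (W a) k v)) ⟨
    ∑□ (λ v → sum (λ b → 𝟙 (matches (W b) v ∧ ball (W a) k v))) ≤⟨ ∑□-mono (λ v → once v (ball (W a) k v)) ⟩
    count (ball (W a) k)                                     ≤⟨ count-ball (W a) h k few h≤d ⟩
    2 ^ h * binomialSum (d ∸ h) k                            ∎
    where
    open ≤-Reasoning
    represented : ∀ b → 1 ≤ count (λ v → matches (W b) v ∧ ball (W a) k v)
    represented b = ≤-trans
      (≤-reflexive (sym (cong 𝟙 (cong₂ _∧_ (matches-nearest (W a) (W b))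
        (≤ᵇ-true (≤-trans (≤-reflexive (faceDist-nearest (W a) (W b))) (dist≤k a b)))))))
      (≤∑□ (λ v → 𝟙 (matches (W b) v ∧ ball (W a) k v)) (nearest (W a) (W b)))
    once : ∀ v q → sum (λ b → 𝟙 (matches (W b) v ∧ q)) ≤ 𝟙 q
    once v true  = sum-atMostOne (λ b c p q → matches-unique v b c
      (proj₁ (∧-true (matches (W b) v) p)) (proj₁ (∧-true (matches (W c) v) q)))
    once v false = ≤-trans
      (sum-mono (λ b → ≤-reflexive (trans (𝟙-∧ (matches (W b) v) false) (*-zeroʳ (𝟙 (matches (W b) v))))))
      (≤-reflexive (sum-replicate-zero N))

  covered : ℕ → Subset d → Bool
  covered j v = some (λ a → (stars (W a) ≤ᵇ j) ∧ matches (W a) v)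

  -- S j of the overview, written as a sum over the words so that it can be combined linearly;
  -- `count-covered` identifies it with the size of a set of vertices, as the arguments on Hamming
  -- distance require.
  volume : ℕ → ℕ
  volume j = sum (λ a → 𝟙 (stars (W a) ≤ᵇ j) * 2 ^ stars (W a))

  count-covered : ∀ j → count (covered j) ≡ volume j
  count-covered j = begin
    count (covered j)
      ≡⟨ ∑□-cong (λ v → 𝟙-some (λ a b p q → matches-unique v a b
           (proj₂ (∧-true (stars (W a) ≤ᵇ j) p)) (proj₂ (∧-true (stars (W b) ≤ᵇ j) q)))) ⟩
    ∑□ (λ v → sum (λ a → 𝟙 ((stars (W a) ≤ᵇ j) ∧ matches (W a) v)))
      ≡⟨ ∑□-sum (λ a v → 𝟙 ((stars (W a) ≤ᵇ j) ∧ matches (W a) v)) ⟩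
    sum (λ a → count (λ v → (stars (W a) ≤ᵇ j) ∧ matches (W a) v))
      ≡⟨ sum-cong-≗ (λ a → restricted (stars (W a) ≤ᵇ j) (W a)) ⟩
    volume j ∎
    where
    open ≡-Reasoning
    restricted : ∀ b (w : Word d) → count (λ v → b ∧ matches w v) ≡ 𝟙 b * 2 ^ stars w
    restricted true  w = trans (count-matches w) (sym (+-identityʳ _))
    restricted false w = count-false d

  covered-close : ∀ i j u v → covered i u ≡ true → covered j v ≡ true → hamming u v ≤ k + (i + j)
  covered-close i j u v p q =
    let a , pa   = some⇒∃ _ p
        b , pb   = some⇒∃ _ q
        sa , mau = ∧-true (stars (W a) ≤ᵇ i) pa
        sb , mbv = ∧-true (stars (W b) ≤ᵇ j) pb
    in ≤-trans (hamming-matches (W a) (W b) u v mau mbv)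
         (+-mono-≤ (dist≤k a b) (+-mono-≤ (true-≤ᵇ (stars (W a)) i sa) (true-≤ᵇ (stars (W b)) j sb)))

  volume-kleitman : ∀ j → k + 2 * j < d → volume j ≤ ∣B∣ (k + 2 * j) d
  volume-kleitman j lt = subst (_≤ ∣B∣ (k + 2 * j) d) (count-covered j)
    (kleitman d (k + 2 * j) (covered j) lt
      (λ u v p q → ≤-trans (covered-close j j u v p q)
        (≤-reflexive (cong (λ x → k + (j + x)) (sym (+-identityʳ j))))))

  volume-pair : ∀ i j → k + (i + j) < d → volume i + volume j ≤ 2 ^ d
  volume-pair i j lt = subst₂ (λ x y → x + y ≤ 2 ^ d) (count-covered i) (count-covered j)
    (count-antipodal (covered i) (covered j)
      (λ u v p q → ≤-<-trans (covered-close i j u v p q) lt))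

  volume≤2^d : ∀ j → volume j ≤ 2 ^ d
  volume≤2^d j = subst (_≤ 2 ^ d) (count-covered j) (count≤2^n (covered j))

  totalVolume≤2^d : sum (λ a → 2 ^ stars (W a)) ≤ 2 ^ d
  totalVolume≤2^d = ≤-trans
    (≤-reflexive (sum-cong-≗ (λ a → trans (sym (*-identityˡ _))
      (cong (λ b → 𝟙 b * 2 ^ stars (W a)) (sym (≤ᵇ-true (stars≤d (W a))))))))
    (volume≤2^d d)

-- Summation by parts

toℚᵘ-fromℕ : ∀ n → toℚᵘ (fromℕ n) ℚᵘ.≃ mkℚᵘ (ℤ.+ n) 0
toℚᵘ-fromℕ n = ℚ.toℚᵘ-fromℚᵘ (mkℚᵘ (ℤ.+ n) 0)

fromℕ-+ : ∀ m n → fromℕ (m + n) ≡ fromℕ m ℚ.+ fromℕ n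
fromℕ-+ m n = ℚ.toℚᵘ-injective (begin-equality
  toℚᵘ (fromℕ (m + n))                      ≃⟨ toℚᵘ-fromℕ (m + n) ⟩
  mkℚᵘ (ℤ.+ (m + n)) 0                      ≃⟨ *≡* (cong (ℤ._* ℤ.+ 1) (cong₂ ℤ._+_ (ℤ.*-identityʳ (ℤ.+ m)) (ℤ.*-identityʳ (ℤ.+ n)))) ⟨
  mkℚᵘ (ℤ.+ m) 0 ℚᵘ.+ mkℚᵘ (ℤ.+ n) 0        ≃⟨ ℚᵘ.+-cong (toℚᵘ-fromℕ m) (toℚᵘ-fromℕ n) ⟨
  toℚᵘ (fromℕ m) ℚᵘ.+ toℚᵘ (fromℕ n)        ≃⟨ ℚ.toℚᵘ-homo-+ (fromℕ m) (fromℕ n) ⟨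
  toℚᵘ (fromℕ m ℚ.+ fromℕ n)                ∎)
  where open ℚᵘ.≤-Reasoning

fromℕ-* : ∀ m n → fromℕ (m * n) ≡ fromℕ m ℚ.* fromℕ n
fromℕ-* m n = ℚ.toℚᵘ-injective (begin-equality
  toℚᵘ (fromℕ (m * n))                      ≃⟨ toℚᵘ-fromℕ (m * n) ⟩
  mkℚᵘ (ℤ.+ (m * n)) 0                      ≃⟨ *≡* (cong (ℤ._* ℤ.+ 1) (ℤ.pos-* m n)) ⟩
  mkℚᵘ (ℤ.+ m) 0 ℚᵘ.* mkℚᵘ (ℤ.+ n) 0        ≃⟨ ℚᵘ.*-cong (toℚᵘ-fromℕ m) (toℚᵘ-fromℕ n) ⟨
  toℚᵘ (fromℕ m) ℚᵘ.* toℚᵘ (fromℕ n)        ≃⟨ ℚ.toℚᵘ-homo-* (fromℕ m) (fromℕ n) ⟨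
  toℚᵘ (fromℕ m ℚ.* fromℕ n)                ∎)
  where open ℚᵘ.≤-Reasoning

fromℕ-mono : ∀ {m n} → m ≤ n → fromℕ m ℚ.≤ fromℕ n
fromℕ-mono {m} {n} m≤n = ℚ.toℚᵘ-cancel-≤ (begin
  toℚᵘ (fromℕ m)   ≃⟨ toℚᵘ-fromℕ m ⟩
  mkℚᵘ (ℤ.+ m) 0   ≤⟨ *≤* (ℤ.*-monoʳ-≤-nonNeg (ℤ.+ 1) (ℤ.+≤+ m≤n)) ⟩
  mkℚᵘ (ℤ.+ n) 0   ≃⟨ toℚᵘ-fromℕ n ⟨
  toℚᵘ (fromℕ n)   ∎)
  where open ℚᵘ.≤-Reasoning

fromℕ-reciprocal : ∀ n → (ℤ.+ 1 ℚ./ suc n) ℚ.* fromℕ (suc n) ≡ 1ℚ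
fromℕ-reciprocal n = ℚ.toℚᵘ-injective (begin-equality
  toℚᵘ ((ℤ.+ 1 ℚ./ suc n) ℚ.* fromℕ (suc n))          ≃⟨ ℚ.toℚᵘ-homo-* (ℤ.+ 1 ℚ./ suc n) (fromℕ (suc n)) ⟩
  toℚᵘ (ℤ.+ 1 ℚ./ suc n) ℚᵘ.* toℚᵘ (fromℕ (suc n))    ≃⟨ ℚᵘ.*-cong (ℚ.toℚᵘ-fromℚᵘ (mkℚᵘ (ℤ.+ 1) n)) (toℚᵘ-fromℕ (suc n)) ⟩
  mkℚᵘ (ℤ.+ 1) n ℚᵘ.* mkℚᵘ (ℤ.+ suc n) 0              ≃⟨ *≡* (cong ℤ.+_ (ring n)) ⟩
  ℚᵘ.1ℚᵘ                                              ∎)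
  where
  open ℚᵘ.≤-Reasoning
  ring : ∀ n → (suc n + 0) * 1 ≡ suc n * 1 + 0
  ring = solve-∀

1/2^-* : ∀ n → 1/2^ n ℚ.* fromℕ (2 ^ n) ≡ 1ℚ
1/2^-* n with 2 ^ n | m^n≢0 2 n
... | suc m | _ = fromℕ-reciprocal m

1/2^-*-+ : ∀ m n → 1/2^ m ℚ.* fromℕ (2 ^ (m + n)) ≡ fromℕ (2 ^ n)
1/2^-*-+ m n = begin
  1/2^ m ℚ.* fromℕ (2 ^ (m + n))                  ≡⟨ cong (λ x → 1/2^ m ℚ.* fromℕ x) (^-distribˡ-+-* 2 m n) ⟩
  1/2^ m ℚ.* fromℕ (2 ^ m * 2 ^ n)                ≡⟨ cong (1/2^ m ℚ.*_) (fromℕ-* (2 ^ m) (2 ^ n)) ⟩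
  1/2^ m ℚ.* (fromℕ (2 ^ m) ℚ.* fromℕ (2 ^ n))    ≡⟨ ℚ.*-assoc (1/2^ m) _ _ ⟨
  1/2^ m ℚ.* fromℕ (2 ^ m) ℚ.* fromℕ (2 ^ n)      ≡⟨ cong (ℚ._* fromℕ (2 ^ n)) (1/2^-* m) ⟩
  1ℚ ℚ.* fromℕ (2 ^ n)                            ≡⟨ ℚ.*-identityˡ _ ⟩
  fromℕ (2 ^ n)                                   ∎
  where open ≡-Reasoning

1/2^-suc : ∀ n → 1/2^ n ≡ 1/2^ (suc n) ℚ.+ 1/2^ (suc n)
1/2^-suc n = begin
  1/2^ n                                             ≡⟨ ℚ.*-identityʳ _ ⟨
  1/2^ n ℚ.* 1ℚ                                      ≡⟨ cong (1/2^ n ℚ.*_) (1/2^-* (suc n)) ⟨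
  1/2^ n ℚ.* (q ℚ.* fromℕ (2 ^ suc n))               ≡⟨ cong (λ x → 1/2^ n ℚ.* (q ℚ.* x)) (trans (cong (λ x → fromℕ (2 ^ n + x)) (+-identityʳ (2 ^ n))) (fromℕ-+ (2 ^ n) (2 ^ n))) ⟩
  1/2^ n ℚ.* (q ℚ.* (fromℕ (2 ^ n) ℚ.+ fromℕ (2 ^ n))) ≡⟨ regroup (1/2^ n) q (fromℕ (2 ^ n)) ⟩
  1/2^ n ℚ.* fromℕ (2 ^ n) ℚ.* (q ℚ.+ q)             ≡⟨ cong (ℚ._* (q ℚ.+ q)) (1/2^-* n) ⟩
  1ℚ ℚ.* (q ℚ.+ q)                                   ≡⟨ ℚ.*-identityˡ _ ⟩
  q ℚ.+ q                                            ∎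
  where
  open ≡-Reasoning
  q = 1/2^ (suc n)
  regroup : ∀ a b c → a ℚ.* (b ℚ.* (c ℚ.+ c)) ≡ a ℚ.* c ℚ.* (b ℚ.+ b)
  regroup = solve 3 (λ a b c → a :* (b :* (c :+ c)) := a :* c :* (b :+ b)) refl
    where open ℚ.+-*-Solver

0≤1/2^ : ∀ n → 0ℚ ℚ.≤ 1/2^ n
0≤1/2^ n = ℚ.nonNegative⁻¹ (1/2^ n) {{ℚ.normalize-nonNeg 1 (2 ^ n) {{m^n≢0 2 n}}}}

1/2^-antimono : ∀ {m n} → m ≤ n → 1/2^ n ℚ.≤ 1/2^ m
1/2^-antimono {m} m≤n with m≤n⇒∃[o]m+o≡n m≤n
... | o , refl = go o
  where
  go : ∀ o → 1/2^ (m + o) ℚ.≤ 1/2^ m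
  go zero    = ℚ.≤-reflexive (cong 1/2^ (+-identityʳ m))
  go (suc o) = ℚ.≤-trans (begin
    1/2^ (m + suc o)                           ≡⟨ cong 1/2^ (+-suc m o) ⟩
    1/2^ (suc (m + o))                         ≡⟨ ℚ.+-identityʳ _ ⟨
    1/2^ (suc (m + o)) ℚ.+ 0ℚ                  ≤⟨ ℚ.+-monoʳ-≤ (1/2^ (suc (m + o))) (0≤1/2^ (suc (m + o))) ⟩
    1/2^ (suc (m + o)) ℚ.+ 1/2^ (suc (m + o))  ≡⟨ 1/2^-suc (m + o) ⟨
    1/2^ (m + o)                               ∎) (go o)
    where open ℚ.≤-Reasoning

-- `sumFromTo` with the number of summands as parameter, which keeps truncated subtraction out of
-- the inductions.
sumFrom : ℕ → ℕ → (ℕ → ℚ) → ℚ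
sumFrom a n f = List.foldr ℚ._+_ 0ℚ (List.map f (List.applyUpTo (a +_) n))

sumFrom-∷ : ∀ a n f → sumFrom a (suc n) f ≡ f a ℚ.+ sumFrom (suc a) n f
sumFrom-∷ a n f = cong₂ ℚ._+_ (cong f (+-identityʳ a))
  (cong (List.foldr ℚ._+_ 0ℚ ∘ List.map f) (applyUpTo-cong n (+-suc a)))
  where
  applyUpTo-cong : ∀ {g h : ℕ → ℕ} n → (∀ i → g i ≡ h i) → List.applyUpTo g n ≡ List.applyUpTo h n
  applyUpTo-cong zero    g≗h = refl
  applyUpTo-cong (suc n) g≗h = cong₂ List._∷_ (g≗h 0) (applyUpTo-cong n (g≗h ∘ suc))

sumFrom-∷ʳ : ∀ a n f → sumFrom a (suc n) f ≡ sumFrom a n f ℚ.+ f (a + n)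
sumFrom-∷ʳ a zero    f = ℚ.+-comm (f (a + 0)) 0ℚ
sumFrom-∷ʳ a (suc n) f = begin
  sumFrom a (2 + n) f                                    ≡⟨ sumFrom-∷ a (suc n) f ⟩
  f a ℚ.+ sumFrom (suc a) (suc n) f                      ≡⟨ cong (f a ℚ.+_) (sumFrom-∷ʳ (suc a) n f) ⟩
  f a ℚ.+ (sumFrom (suc a) n f ℚ.+ f (suc a + n))        ≡⟨ ℚ.+-assoc (f a) _ _ ⟨
  (f a ℚ.+ sumFrom (suc a) n f) ℚ.+ f (suc a + n)        ≡⟨ cong₂ ℚ._+_ (sumFrom-∷ a n f) (cong f (+-suc a n)) ⟨
  sumFrom a (suc n) f ℚ.+ f (a + suc n)                  ∎
  where open ≡-Reasoning

-- The interval of length wide L r has r positions on each side of a central part of length L.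
wide : ℕ → ℕ → ℕ
wide L zero    = L
wide L (suc r) = suc (suc (wide L r))

-- In the application s j is the volume, b j the bound from Kleitman's theorem, P is 2^d and e is d
-- - k.
module _ (s b : ℕ → ℚ) (P : ℚ) (e : ℕ) where

  private
    t g : ℕ → ℚ
    t j = 1/2^ (j + 1) ℚ.* s j
    g j = (1/2^ (j + 1) ℚ.- 1/2^ (e ∸ j)) ℚ.* b j

  -- Pair the summand at i with the one at e - 1 - i.
  pairing : ∀ L r lo c → lo + r ≡ c → lo + (lo + wide L r) ≡ e →
    (∀ j → j < c → s j ℚ.≤ b j) → (∀ i j → suc (i + j) ≡ e → s i ℚ.+ s j ℚ.≤ P) →
    sumFrom lo (wide L r) t ℚ.+ 1/2^ (lo + wide L r) ℚ.* P ℚ.≤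
    sumFrom lo r g ℚ.+ (sumFrom c L t ℚ.+ 1/2^ (c + L) ℚ.* P)
  pairing L zero    lo c lo+r≡c width s≤b s+s≤P rewrite trans (sym (+-identityʳ lo)) lo+r≡c =
    ℚ.≤-reflexive (sym (ℚ.+-identityˡ _))
  pairing L (suc r) lo c lo+r≡c width s≤b s+s≤P = begin
    sumFrom lo (2 + n) t ℚ.+ 1/2^ (lo + (2 + n)) ℚ.* P
      ≡⟨ cong₂ (λ x y → x ℚ.+ 1/2^ y ℚ.* P)
           (trans (sumFrom-∷ lo (suc n) t) (cong (t lo ℚ.+_) (sumFrom-∷ʳ (suc lo) n t)))
           (trans (+-suc lo (suc n)) (cong suc (+-suc lo n))) ⟩
    (t lo ℚ.+ (S ℚ.+ 1/2^ (j′ + 1) ℚ.* s j′)) ℚ.+ q ℚ.* P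
      ≡⟨ cong (λ y → (t lo ℚ.+ (S ℚ.+ 1/2^ y ℚ.* s j′)) ℚ.+ q ℚ.* P) (+-comm j′ 1) ⟩
    (p ℚ.* s lo ℚ.+ (S ℚ.+ q ℚ.* s j′)) ℚ.+ q ℚ.* P
      ≡⟨ regroup₁ p q (s lo) (s j′) S P ⟩
    -- Of the weight p of `s lo` only the part q, the weight of its partner, enters the pair bounded
    -- by P. The resulting q P equals the present remainder, and the two together are the remainder
    -- of the window without its outermost indices.
    (p ℚ.- q) ℚ.* s lo ℚ.+ (S ℚ.+ (q ℚ.* (s lo ℚ.+ s j′) ℚ.+ q ℚ.* P))
      ≤⟨ ℚ.+-mono-≤
           (ℚ.*-monoˡ-≤-nonNeg (p ℚ.- q) {{ℚ.nonNegative 0≤p-q}} (s≤b lo lo<c))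
           (ℚ.+-monoʳ-≤ S (ℚ.+-monoˡ-≤ (q ℚ.* P)
             (ℚ.*-monoˡ-≤-nonNeg q {{ℚ.nonNegative (0≤1/2^ (suc j′))}} (s+s≤P lo j′ lo+j′+1≡e)))) ⟩
    (p ℚ.- q) ℚ.* b lo ℚ.+ (S ℚ.+ (q ℚ.* P ℚ.+ q ℚ.* P))
      ≡⟨ cong₂ (λ x y → (p ℚ.- 1/2^ x) ℚ.* b lo ℚ.+ (S ℚ.+ y)) 1+j′≡e∸lo
           (trans (sym (ℚ.*-distribʳ-+ P q q)) (cong (ℚ._* P) (sym (1/2^-suc j′)))) ⟩
    g lo ℚ.+ (S ℚ.+ 1/2^ j′ ℚ.* P)
      ≤⟨ ℚ.+-monoʳ-≤ (g lo) (pairing L r (suc lo) c (trans (sym (+-suc lo r)) lo+r≡c)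
           (trans (cong suc (+-suc lo (lo + n))) (trans step width)) s≤b s+s≤P) ⟩
    g lo ℚ.+ (sumFrom (suc lo) r g ℚ.+ (sumFrom c L t ℚ.+ 1/2^ (c + L) ℚ.* P))
      ≡⟨ ℚ.+-assoc (g lo) _ _ ⟨
    (g lo ℚ.+ sumFrom (suc lo) r g) ℚ.+ (sumFrom c L t ℚ.+ 1/2^ (c + L) ℚ.* P)
      ≡⟨ cong (ℚ._+ (sumFrom c L t ℚ.+ 1/2^ (c + L) ℚ.* P)) (sumFrom-∷ lo r g) ⟨
    sumFrom lo (suc r) g ℚ.+ (sumFrom c L t ℚ.+ 1/2^ (c + L) ℚ.* P) ∎
    where
    open ℚ.≤-Reasoning
    n = wide L r
    j′ = suc lo + n
    p = 1/2^ (lo + 1)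
    q = 1/2^ (suc j′)
    S = sumFrom (suc lo) n t
    step : suc (suc (lo + (lo + n))) ≡ lo + (lo + (2 + n))
    step = arith lo n
      where
      arith : ∀ a b → suc (suc (a + (a + b))) ≡ a + (a + (2 + b))
      arith = solve-∀
    lo<c : lo < c
    lo<c = subst (lo <_) lo+r≡c (m<m+n lo (s≤s z≤n))
    lo+j′+1≡e : suc (lo + j′) ≡ e
    lo+j′+1≡e = trans (cong suc (+-suc lo (lo + n))) (trans step width)
    1+j′≡e∸lo : suc j′ ≡ e ∸ lo
    1+j′≡e∸lo = sym (trans (cong (_∸ lo) (trans (sym lo+j′+1≡e) (sym (+-suc lo j′)))) (m+n∸m≡n lo (suc j′)))
    0≤p-q : 0ℚ ℚ.≤ p ℚ.- q
    0≤p-q = ℚ.≤-trans (ℚ.≤-reflexive (sym (ℚ.+-inverseʳ q))) (ℚ.+-monoˡ-≤ (ℚ.- q)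
      (1/2^-antimono (≤-trans (≤-reflexive (+-comm lo 1)) (s≤s (≤-trans (m≤m+n lo n) (n≤1+n _))))))
    regroup₁ : ∀ p q x y S P → (p ℚ.* x ℚ.+ (S ℚ.+ q ℚ.* y)) ℚ.+ q ℚ.* P ≡
                               (p ℚ.- q) ℚ.* x ℚ.+ (S ℚ.+ (q ℚ.* (x ℚ.+ y) ℚ.+ q ℚ.* P))
    regroup₁ = solve 6 (λ p q x y S P → (p :* x :+ (S :+ q :* y)) :+ q :* P :=
                                        (p :- q) :* x :+ (S :+ (q :* (x :+ y) :+ q :* P))) refl
      where open ℚ.+-*-Solver

-- partial lo n s is 2^(lo+n) times the sum of 2^s / 2^(j+1) over all j ≥ s with lo ≤ j < lo + n;
-- together with 2^s / 2^(lo+n) that sum is at least 1.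

partial : ℕ → ℕ → ℕ → ℕ
partial lo zero    s = 0
partial lo (suc n) s = 2 * partial lo n s + 𝟙 (s ≤ᵇ lo + n) * 2 ^ s

partial-bound : ∀ lo n s → lo ≤ s → 2 ^ (lo + n) ≤ partial lo n s + 2 ^ s
partial-bound lo zero    s lo≤s = ≤-trans (≤-reflexive (cong (2 ^_) (+-identityʳ lo))) (^-monoʳ-≤ 2 lo≤s)
partial-bound lo (suc n) s lo≤s with s ≤? lo + n
... | yes s≤ rewrite ≤ᵇ-true s≤ = begin
  2 ^ (lo + suc n)                         ≡⟨ cong (2 ^_) (+-suc lo n) ⟩
  2 * 2 ^ (lo + n)                         ≤⟨ *-monoʳ-≤ 2 (partial-bound lo n s lo≤s) ⟩
  2 * (partial lo n s + 2 ^ s)             ≡⟨ regroup (partial lo n s) (2 ^ s) ⟩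
  2 * partial lo n s + (2 ^ s + 0) + 2 ^ s ∎
  where
  open ≤-Reasoning
  regroup : ∀ a b → 2 * (a + b) ≡ 2 * a + (b + 0) + b
  regroup = solve-∀
... | no s≰ = m≤n⇒m≤o+n _ (^-monoʳ-≤ 2 (≤-trans (≤-reflexive (+-suc lo n)) (≰⇒> s≰)))

module _ {k d N} {W : Vector (Word d) N} (nb : NeighborlyWords k W) where

  private
    t : ℕ → ℚ
    t j = 1/2^ (j + 1) ℚ.* fromℕ (volume nb j)

    partialSum : ℕ → ℕ → ℕ
    partialSum lo n = sum (λ a → partial lo n (stars (W a)))

    partialSum-suc : ∀ lo n → partialSum lo (suc n) ≡ 2 * partialSum lo n + volume nb (lo + n)
    partialSum-suc lo n = trans
      (∑-distrib-+ (λ a → 2 * partial lo n (stars (W a))) (λ a → 𝟙 (stars (W a) ≤ᵇ lo + n) * 2 ^ stars (W a)))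
      (cong (_+ volume nb (lo + n)) (sym (*-distribˡ-sum 2 (λ a → partial lo n (stars (W a))))))

    partialSum-sumFrom : ∀ lo n → 1/2^ (lo + n) ℚ.* fromℕ (partialSum lo n) ≡ sumFrom lo n t
    partialSum-sumFrom lo zero = trans
      (cong (λ x → 1/2^ (lo + 0) ℚ.* fromℕ x) (sum-replicate-zero N)) (ℚ.*-zeroʳ (1/2^ (lo + 0)))
    partialSum-sumFrom lo (suc n) = begin
      1/2^ (lo + suc n) ℚ.* fromℕ (partialSum lo (suc n))
        ≡⟨ cong₂ (λ x y → 1/2^ x ℚ.* y) (+-suc lo n) split ⟩
      q ℚ.* ((X ℚ.+ X) ℚ.+ V)
        ≡⟨ regroup q X V ⟩
      (q ℚ.+ q) ℚ.* X ℚ.+ q ℚ.* V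
        ≡⟨ cong₂ (λ x y → x ℚ.* X ℚ.+ 1/2^ y ℚ.* V) (sym (1/2^-suc (lo + n))) (+-comm 1 (lo + n)) ⟩
      1/2^ (lo + n) ℚ.* X ℚ.+ t (lo + n)
        ≡⟨ cong (ℚ._+ t (lo + n)) (partialSum-sumFrom lo n) ⟩
      sumFrom lo n t ℚ.+ t (lo + n)
        ≡⟨ sumFrom-∷ʳ lo n t ⟨
      sumFrom lo (suc n) t ∎
      where
      open ≡-Reasoning
      q = 1/2^ (suc (lo + n))
      X = fromℕ (partialSum lo n)
      V = fromℕ (volume nb (lo + n))
      split : fromℕ (partialSum lo (suc n)) ≡ (X ℚ.+ X) ℚ.+ V
      split = trans (cong fromℕ (partialSum-suc lo n))
        (trans (fromℕ-+ (2 * partialSum lo n) _)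
          (cong (ℚ._+ V) (trans (cong (λ x → fromℕ (partialSum lo n + x)) (+-identityʳ (partialSum lo n)))
                                (fromℕ-+ (partialSum lo n) (partialSum lo n)))))
      regroup : ∀ q X V → q ℚ.* ((X ℚ.+ X) ℚ.+ V) ≡ (q ℚ.+ q) ℚ.* X ℚ.+ q ℚ.* V
      regroup = solve 3 (λ q X V → q :* ((X :+ X) :+ V) := (q :+ q) :* X :+ q :* V) refl
        where open ℚ.+-*-Solver

  -- `partial-bound` summed over the words and divided by 2^(lo+n): the partial sums turn into
  -- weighted volumes, and the remaining 2^s add up to at most 2^d because the faces are disjoint.
  size-manyStars : ∀ lo n → (∀ a → lo ≤ stars (W a)) →
    fromℕ N ℚ.≤ sumFrom lo n t ℚ.+ 1/2^ (lo + n) ℚ.* fromℕ (2 ^ d)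
  size-manyStars lo n many = begin
    fromℕ N
      ≡⟨ ℚ.*-identityˡ _ ⟨
    1ℚ ℚ.* fromℕ N
      ≡⟨ cong (ℚ._* fromℕ N) (1/2^-* (lo + n)) ⟨
    1/2^ (lo + n) ℚ.* fromℕ (2 ^ (lo + n)) ℚ.* fromℕ N
      ≡⟨ trans (ℚ.*-assoc (1/2^ (lo + n)) _ _) (cong (1/2^ (lo + n) ℚ.*_) (sym (fromℕ-* (2 ^ (lo + n)) N))) ⟩
    1/2^ (lo + n) ℚ.* fromℕ (2 ^ (lo + n) * N)
      ≤⟨ ℚ.*-monoˡ-≤-nonNeg (1/2^ (lo + n)) {{ℚ.nonNegative (0≤1/2^ (lo + n))}} (fromℕ-mono total) ⟩
    1/2^ (lo + n) ℚ.* fromℕ (partialSum lo n + 2 ^ d)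
      ≡⟨ trans (cong (1/2^ (lo + n) ℚ.*_) (fromℕ-+ (partialSum lo n) (2 ^ d))) (ℚ.*-distribˡ-+ (1/2^ (lo + n)) _ _) ⟩
    1/2^ (lo + n) ℚ.* fromℕ (partialSum lo n) ℚ.+ 1/2^ (lo + n) ℚ.* fromℕ (2 ^ d)
      ≡⟨ cong (ℚ._+ 1/2^ (lo + n) ℚ.* fromℕ (2 ^ d)) (partialSum-sumFrom lo n) ⟩
    sumFrom lo n t ℚ.+ 1/2^ (lo + n) ℚ.* fromℕ (2 ^ d) ∎
    where
    open ℚ.≤-Reasoning
    total : 2 ^ (lo + n) * N ≤ partialSum lo n + 2 ^ d
    total = ≤-trans (≤-reflexive (trans (cong (2 ^ (lo + n) *_) (sym (sum-1 N))) (*-distribˡ-sum {N} (2 ^ (lo + n)) (λ _ → 1))))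
      (≤-trans (sum-mono (λ a → ≤-trans (≤-reflexive (*-identityʳ _)) (partial-bound lo n (stars (W a)) (many a))))
        (≤-trans (≤-reflexive (∑-distrib-+ (λ a → partial lo n (stars (W a))) _))
          (+-monoʳ-≤ (partialSum lo n) (totalVolume≤2^d nb))))

  size-dichotomy : ∀ h {X} → h ≤ d →
    ((∀ a → suc h ≤ stars (W a)) → fromℕ N ℚ.≤ X) →
    fromℕ N ℚ.≤ fromℕ (2 ^ h * binomialSum (d ∸ h) k) ⊔ X
  size-dichotomy h {X} h≤d bound with Fin.all? (λ a → suc h ≤? stars (W a))
  ... | yes many = ℚ.≤-trans (bound many) (ℚ.p≤q⊔p (fromℕ (2 ^ h * binomialSum (d ∸ h) k)) X)
  ... | no ¬many with Fin.¬∀⟶∃¬ N _ (λ a → suc h ≤? stars (W a)) ¬many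
  ... | a , few = ℚ.≤-trans (fromℕ-mono (size-fewStars nb a h (s≤s⁻¹ (≰⇒> few)) h≤d)) (ℚ.p≤p⊔q _ X)

  -- The window reaches from lo to its partner e - 1 - lo. The L indices from c on are left
  -- unpaired: none for even e, and for odd e the middle index (e - 1) / 2, which is its own
  -- partner.
  size-paired : ∀ e L r lo c → k + e ≡ d → lo + r ≡ c → c + c + L ≡ e → (∀ a → lo ≤ stars (W a)) →
    fromℕ N ℚ.≤ sumFrom lo r (λ j → (1/2^ (j + 1) ℚ.- 1/2^ (e ∸ j)) ℚ.* fromℕ (∣B∣ (k + 2 * j) d))
                ℚ.+ (sumFrom c L t ℚ.+ 1/2^ (c + L) ℚ.* fromℕ (2 ^ d))
  size-paired e L r lo c k+e≡d lo+r≡c c+c+L≡e many = ℚ.≤-trans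
    (size-manyStars lo (wide L r) many)
    (pairing (fromℕ ∘ volume nb) (λ j → fromℕ (∣B∣ (k + 2 * j) d)) (fromℕ (2 ^ d)) e
      L r lo c lo+r≡c (trans (width lo r c lo+r≡c) c+c+L≡e)
      (λ j j<c → fromℕ-mono (volume-kleitman nb j (subst (k + 2 * j <_) k+e≡d (+-monoʳ-< k (2j<e j j<c)))))
      (λ i j i+j → ℚ.≤-trans (ℚ.≤-reflexive (sym (fromℕ-+ (volume nb i) (volume nb j))))
        (fromℕ-mono (volume-pair nb i j (subst (k + (i + j) <_) k+e≡d (+-monoʳ-< k (≤-reflexive i+j)))))))
    where
    width : ∀ lo r c → lo + r ≡ c → lo + (lo + wide L r) ≡ c + c + L
    width lo zero    c refl = arith lo L
      where
      arith : ∀ a b → a + (a + b) ≡ (a + 0) + (a + 0) + b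
      arith = solve-∀
    width lo (suc r) c eq = trans (arith lo (wide L r)) (width (suc lo) r c (trans (sym (+-suc lo r)) eq))
      where
      arith : ∀ a b → a + (a + (2 + b)) ≡ suc a + (suc a + b)
      arith = solve-∀
    2j<e : ∀ j → j < c → 2 * j < e
    2j<e j j<c = subst (2 * j <_) c+c+L≡e
      (≤-trans (≤-reflexive (cong (λ x → suc (j + x)) (+-identityʳ j)))
        (≤-trans (+-mono-≤ j<c (<⇒≤ j<c)) (m≤m+n (c + c) L)))

-- The three bounds for families of words

2*n/2 : ∀ n → (2 * n) / 2 ≡ n
2*n/2 n = trans (cong (_/ 2) (*-comm 2 n)) (m*n/n≡m n 2)

sumFromTo-sumFrom : ∀ {a b r} f → suc b ≡ a + r → sumFromTo a b f ≡ sumFrom a r f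
sumFromTo-sumFrom {a} {b} {r} f eq = cong (λ n → sumFrom a n f) (trans (cong (_∸ a) eq) (m+n∸m≡n a r))

WordBound : ℕ → ℕ → ℚ → Set
WordBound k d X = ∀ {N} (W : Vector (Word d) N) → NeighborlyWords k W → fromℕ N ℚ.≤ X

-- With e = 2 m all indices of the window are paired off, and the remainder 2^d / 2^m has exponent k
-- + m = (d + k) / 2.
bound-even : ∀ k d h r e → k + e ≡ d → e ≡ 2 * (suc h + r) →
  WordBound k d
    ( fromℕ (2 ^ h * binomialSum (d ∸ h) k)
      ⊔
      ( sumFromTo (suc h) ((e ∸ 2) / 2)
          (λ j → (1/2^ (j + 1) ℚ.- 1/2^ (e ∸ j)) ℚ.* fromℕ (∣B∣ (k + 2 * j) d))
        ℚ.+ fromℕ (2 ^ ((d + k) / 2)) ) )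
bound-even k d h r e refl refl W nb = size-dichotomy nb h h≤d λ many →
  ℚ.≤-trans (size-paired nb e 0 r (suc h) m refl refl (m+m≡e h r) many)
    (ℚ.≤-reflexive (cong₂ ℚ._+_ (sym (sumFromTo-sumFrom {suc h} {r = r} g (cong suc half₁))) (begin
      0ℚ ℚ.+ 1/2^ (m + 0) ℚ.* fromℕ (2 ^ (k + e))  ≡⟨ ℚ.+-identityˡ _ ⟩
      1/2^ (m + 0) ℚ.* fromℕ (2 ^ (k + e))         ≡⟨ cong₂ (λ x y → 1/2^ x ℚ.* fromℕ (2 ^ y)) (+-identityʳ m) (split k m) ⟩
      1/2^ m ℚ.* fromℕ (2 ^ (m + (k + m)))         ≡⟨ 1/2^-*-+ m (k + m) ⟩
      fromℕ (2 ^ (k + m))                          ≡⟨ cong (λ x → fromℕ (2 ^ x)) half₂ ⟨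
      fromℕ (2 ^ ((k + e + k) / 2))                ∎)))
  where
  open ≡-Reasoning
  m = suc h + r
  g = λ j → (1/2^ (j + 1) ℚ.- 1/2^ (e ∸ j)) ℚ.* fromℕ (∣B∣ (k + 2 * j) (k + e))
  h≤d : h ≤ k + e
  h≤d = m≤n⇒m≤o+n k (m≤n⇒m≤n+o (m + 0) (m≤n⇒m≤n+o r (n≤1+n h)))
  m+m≡e : ∀ h r → suc (h + r) + suc (h + r) + 0 ≡ 2 * suc (h + r)
  m+m≡e = solve-∀
  half₁ : (e ∸ 2) / 2 ≡ h + r
  half₁ = trans (cong (λ x → (x ∸ 2) / 2) (*-suc 2 (h + r))) (2*n/2 (h + r))
  split : ∀ k m → k + 2 * m ≡ m + (k + m)
  split = solve-∀
  half₂ : (k + e + k) / 2 ≡ k + m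
  half₂ = trans (cong (_/ 2) (double k m)) (2*n/2 (k + m))
    where
    double : ∀ k m → k + 2 * m + k ≡ 2 * (k + m)
    double = solve-∀

-- With e = 2 m + 1 the middle index m satisfies k + 2 m = d - 1, the largest diameter that
-- `kleitman` admits; its weight 1/2^(m+1) gives the term with `∣B∣ (d ∸ 1) d`. The remainder is 2^d
-- / 2^(m+1), of exponent k + m = (d + k - 1) / 2.
bound-odd : ∀ k d h r e → k + e ≡ d → e ≡ suc (2 * (suc h + r)) →
  WordBound k d
    ( fromℕ (2 ^ h * binomialSum (d ∸ h) k)
      ⊔
      ( sumFromTo (suc h) ((e ∸ 3) / 2)
          (λ j → (1/2^ (j + 1) ℚ.- 1/2^ (e ∸ j)) ℚ.* fromℕ (∣B∣ (k + 2 * j) d))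
        ℚ.+ 1/2^ ((e + 1) / 2) ℚ.* fromℕ (∣B∣ (d ∸ 1) d)
        ℚ.+ fromℕ (2 ^ ((d + k ∸ 1) / 2)) ) )
bound-odd k d h r e refl refl {N} W nb = size-dichotomy nb h h≤d λ many → begin
  fromℕ N
    ≤⟨ size-paired nb e 1 r (suc h) m refl refl (m+m≡e h r) many ⟩
  sumFrom (suc h) r g ℚ.+ (1/2^ ((m + 0) + 1) ℚ.* fromℕ (volume nb (m + 0)) ℚ.+ 0ℚ ℚ.+ 1/2^ (m + 1) ℚ.* fromℕ (2 ^ d′))
    ≡⟨ cong (λ x → sumFrom (suc h) r g ℚ.+ (1/2^ (x + 1) ℚ.* fromℕ (volume nb x) ℚ.+ 0ℚ ℚ.+ 1/2^ (m + 1) ℚ.* fromℕ (2 ^ d′))) (+-identityʳ m) ⟩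
  sumFrom (suc h) r g ℚ.+ (1/2^ (m + 1) ℚ.* fromℕ (volume nb m) ℚ.+ 0ℚ ℚ.+ 1/2^ (m + 1) ℚ.* fromℕ (2 ^ d′))
    ≤⟨ ℚ.+-monoʳ-≤ (sumFrom (suc h) r g) (ℚ.+-monoˡ-≤ (1/2^ (m + 1) ℚ.* fromℕ (2 ^ d′)) (ℚ.+-monoˡ-≤ 0ℚ
         (ℚ.*-monoˡ-≤-nonNeg (1/2^ (m + 1)) {{ℚ.nonNegative (0≤1/2^ (m + 1))}}
           (fromℕ-mono (volume-kleitman nb m (≤-reflexive (sym (+-suc k (2 * m))))))))) ⟩
  sumFrom (suc h) r g ℚ.+ (1/2^ (m + 1) ℚ.* fromℕ (∣B∣ (k + 2 * m) d′) ℚ.+ 0ℚ ℚ.+ 1/2^ (m + 1) ℚ.* fromℕ (2 ^ d′))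
    ≡⟨ trans (cong (λ x → sumFrom (suc h) r g ℚ.+ (x ℚ.+ 1/2^ (m + 1) ℚ.* fromℕ (2 ^ d′)))
               (ℚ.+-identityʳ (1/2^ (m + 1) ℚ.* fromℕ (∣B∣ (k + 2 * m) d′))))
             (sym (ℚ.+-assoc (sumFrom (suc h) r g) (1/2^ (m + 1) ℚ.* fromℕ (∣B∣ (k + 2 * m) d′)) _)) ⟩
  sumFrom (suc h) r g ℚ.+ 1/2^ (m + 1) ℚ.* fromℕ (∣B∣ (k + 2 * m) d′) ℚ.+ 1/2^ (m + 1) ℚ.* fromℕ (2 ^ d′)
    ≡⟨ cong₂ ℚ._+_ (cong₂ ℚ._+_ (sym (sumFromTo-sumFrom {suc h} {r = r} g (cong suc half₁)))
         (cong₂ (λ x y → 1/2^ x ℚ.* fromℕ (∣B∣ y d′)) (sym half₃) (sym (cong (_∸ 1) (+-suc k (2 * m))))))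
         (trans (cong (λ y → 1/2^ (m + 1) ℚ.* fromℕ (2 ^ y)) (split k m)) (trans (1/2^-*-+ (m + 1) (k + m)) (cong (λ x → fromℕ (2 ^ x)) (sym half₂)))) ⟩
  sumFromTo (suc h) ((e ∸ 3) / 2) g ℚ.+ 1/2^ ((e + 1) / 2) ℚ.* fromℕ (∣B∣ (d′ ∸ 1) d′) ℚ.+ fromℕ (2 ^ ((d′ + k ∸ 1) / 2)) ∎
  where
  open ℚ.≤-Reasoning
  m = suc h + r
  d′ = k + e
  g = λ j → (1/2^ (j + 1) ℚ.- 1/2^ (e ∸ j)) ℚ.* fromℕ (∣B∣ (k + 2 * j) d′)
  h≤d : h ≤ k + e
  h≤d = m≤n⇒m≤o+n k (m≤n⇒m≤1+n (m≤n⇒m≤n+o (m + 0) (m≤n⇒m≤n+o r (n≤1+n h))))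
  m+m≡e : ∀ h r → suc (h + r) + suc (h + r) + 1 ≡ suc (2 * suc (h + r))
  m+m≡e = solve-∀
  half₁ : (e ∸ 3) / 2 ≡ h + r
  half₁ = trans (cong (λ x → (x ∸ 2) / 2) (*-suc 2 (h + r))) (2*n/2 (h + r))
  split : ∀ k m → k + suc (2 * m) ≡ (m + 1) + (k + m)
  split = solve-∀
  half₂ : (d′ + k ∸ 1) / 2 ≡ k + m
  half₂ = trans (cong (λ x → (x ∸ 1) / 2) (double k m)) (2*n/2 (k + m))
    where
    double : ∀ k m → k + suc (2 * m) + k ≡ suc (2 * (k + m))
    double = solve-∀
  half₃ : (e + 1) / 2 ≡ m + 1
  half₃ = trans (cong (_/ 2) (double m)) (2*n/2 (m + 1))
    where
    double : ∀ m → suc (2 * m) + 1 ≡ 2 * (m + 1)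
    double = solve-∀

-- The dichotomy at h = m = (e - 1) / 2 with an empty window: if every face has at least 2^(m+1)
-- vertices, disjointness alone gives at most 2^(d-m-1) words.
bound-odd₂ : ∀ k d m e → k + e ≡ d → e ≡ suc (2 * m) →
  WordBound k d
    ( fromℕ (2 ^ ((e ∸ 1) / 2) * binomialSum ((d + k + 1) / 2) k)
      ⊔ fromℕ (2 ^ ((d + k ∸ 1) / 2)) )
bound-odd₂ k d m e refl refl {N} W nb =
  subst₂ (λ x y → fromℕ N ℚ.≤ fromℕ (2 ^ x * binomialSum y k) ⊔ fromℕ (2 ^ ((k + e + k ∸ 1) / 2)))
    (sym (2*n/2 m)) d∸m
    (size-dichotomy nb m (m≤n⇒m≤o+n k (m≤n⇒m≤1+n (m≤m+n m (m + 0)))) λ many →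
      ℚ.≤-trans (size-manyStars nb (suc m) 0 many) (ℚ.≤-reflexive (trans (ℚ.+-identityˡ _)
        (trans (cong₂ (λ x y → 1/2^ x ℚ.* fromℕ (2 ^ y)) (+-identityʳ (suc m)) (split k m))
          (trans (1/2^-*-+ (suc m) (k + m)) (cong (λ x → fromℕ (2 ^ x)) (sym half₂)))))))
  where
  split : ∀ k m → k + suc (2 * m) ≡ suc m + (k + m)
  split = solve-∀
  half₂ : (k + e + k ∸ 1) / 2 ≡ k + m
  half₂ = trans (cong (λ x → (x ∸ 1) / 2) (double k m)) (2*n/2 (k + m))
    where
    double : ∀ k m → k + suc (2 * m) + k ≡ suc (2 * (k + m))
    double = solve-∀
  d∸m : k + e ∸ m ≡ (k + e + k + 1) / 2
  d∸m = trans (trans (cong (_∸ m) (shift k m)) (m+n∸m≡n m (suc (k + m))))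
              (sym (trans (cong (_/ 2) (double k m)) (2*n/2 (suc (k + m)))))
    where
    shift : ∀ k m → k + suc (2 * m) ≡ m + suc (k + m)
    shift = solve-∀
    double : ∀ k m → k + suc (2 * m) + k + 1 ≡ 2 * suc (k + m)
    double = solve-∀

-- Real numbers

Eventually : (ℕ → Set) → Set
Eventually P = ∃[ N ] (∀ n → N ≤ n → P n)

eventually₂ : ∀ {P Q R : ℕ → Set} → (∀ n → P n → Q n → R n) → Eventually P → Eventually Q → Eventually R
eventually₂ f (M , p) (N , q) = M ℕ.⊔ N , λ n le →
  f n (p n (m⊔n≤o⇒m≤o M N le)) (q n (m⊔n≤o⇒n≤o M N le))

always : ∀ {P : ℕ → Set} → (∀ n → P n) → Eventually P
always p = 0 , λ n _ → p n

eventually-⊥ : ∀ {P : ℕ → Set} → (∀ n → ¬ P n) → ¬ Eventually P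
eventually-⊥ ¬p (N , p) = ¬p N (p N ≤-refl)

p<p+ε : ∀ p {ε} → 0ℚ ℚ.< ε → p ℚ.< p ℚ.+ ε
p<p+ε p {ε} 0<ε = subst (ℚ._< p ℚ.+ ε) (ℚ.+-identityʳ p) (ℚ.+-monoʳ-< p {0ℚ} {ε} 0<ε)

½*p+½*p : ∀ p → ℚ.½ ℚ.* p ℚ.+ ℚ.½ ℚ.* p ≡ p
½*p+½*p p = trans (sym (ℚ.*-distribʳ-+ p ℚ.½ ℚ.½)) (ℚ.*-identityˡ p)

abstract
  half : ∀ ε → 0ℚ ℚ.< ε → ∃[ η ] (0ℚ ℚ.< η × η ℚ.< ε × η ℚ.+ η ≡ ε)
  half ε 0<ε = ℚ.½ ℚ.* ε , 0<η , subst (ℚ.½ ℚ.* ε ℚ.<_) (½*p+½*p ε) (p<p+ε (ℚ.½ ℚ.* ε) 0<η) , ½*p+½*p ε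
    where
    0<η : 0ℚ ℚ.< ℚ.½ ℚ.* ε
    0<η = ℚ.positive⁻¹ (ℚ.½ ℚ.* ε) {{ℚ.pos*pos⇒pos ℚ.½ ε {{ℚ.positive 0<ε}}}}

p≤∣p∣ : ∀ p → p ℚ.≤ ℚ.∣ p ∣
p≤∣p∣ p with ℚ.≤-total 0ℚ p
... | inj₁ 0≤p = ℚ.≤-reflexive (sym (ℚ.0≤p⇒∣p∣≡p 0≤p))
... | inj₂ p≤0 = ℚ.≤-trans p≤0 (ℚ.0≤∣p∣ p)

-[p-q]≡q-p : ∀ p q → ℚ.- (p ℚ.- q) ≡ q ℚ.- p
-[p-q]≡q-p = solve 2 (λ p q → :- (p :- q) := q :- p) refl
  where open ℚ.+-*-Solver

∣p-q∣≡∣q-p∣ : ∀ p q → ℚ.∣ p ℚ.- q ∣ ≡ ℚ.∣ q ℚ.- p ∣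
∣p-q∣≡∣q-p∣ p q = trans (sym (ℚ.∣-p∣≡∣p∣ (p ℚ.- q))) (cong ℚ.∣_∣ (-[p-q]≡q-p p q))

cancel-mid : ∀ p q → p ≡ q ℚ.+ (p ℚ.- q)
cancel-mid = solve 2 (λ p q → p := q :+ (p :- q)) refl
  where open ℚ.+-*-Solver

∣p-q∣<ε⇒p<q+ε : ∀ p q {ε} → ℚ.∣ p ℚ.- q ∣ ℚ.< ε → p ℚ.< q ℚ.+ ε
∣p-q∣<ε⇒p<q+ε p q {ε} lt = begin-strict
  p                         ≡⟨ cancel-mid p q ⟩
  q ℚ.+ (p ℚ.- q)           ≤⟨ ℚ.+-monoʳ-≤ q (p≤∣p∣ (p ℚ.- q)) ⟩
  q ℚ.+ ℚ.∣ p ℚ.- q ∣       <⟨ ℚ.+-monoʳ-< q lt ⟩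
  q ℚ.+ ε                   ∎
  where open ℚ.≤-Reasoning

p≤q+η⇒p-q<ε : ∀ p q {η ε} → η ℚ.< ε → p ℚ.≤ q ℚ.+ η → p ℚ.- q ℚ.< ε
p≤q+η⇒p-q<ε p q {η} {ε} η<ε p≤q+η = ℚ.≤-<-trans {p ℚ.- q} {η} {ε}
  (subst (p ℚ.- q ℚ.≤_) (cancel q η) (ℚ.+-monoˡ-≤ (ℚ.- q) {p} {q ℚ.+ η} p≤q+η)) η<ε
  where
  open ℚ.+-*-Solver
  cancel : ∀ q ε → q ℚ.+ ε ℚ.- q ≡ ε
  cancel = solve 2 (λ q ε → q :+ ε :- q := ε) refl

∣p-q∣<ε : ∀ p q {η ε} → η ℚ.< ε → p ℚ.≤ q ℚ.+ η → q ℚ.≤ p ℚ.+ η → ℚ.∣ p ℚ.- q ∣ ℚ.< ε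
∣p-q∣<ε p q {η} {ε} η<ε p≤q+η q≤p+η with ℚ.≤-total 0ℚ (p ℚ.- q)
... | inj₁ 0≤p-q = subst (ℚ._< ε) (sym (ℚ.0≤p⇒∣p∣≡p 0≤p-q)) (p≤q+η⇒p-q<ε p q {η} {ε} η<ε p≤q+η)
... | inj₂ p-q≤0 = subst (ℚ._< ε) (sym (trans (∣p-q∣≡∣q-p∣ p q) (ℚ.0≤p⇒∣p∣≡p 0≤q-p))) (p≤q+η⇒p-q<ε q p {η} {ε} η<ε q≤p+η)
  where
  0≤q-p : 0ℚ ℚ.≤ q ℚ.- p
  0≤q-p = subst (0ℚ ℚ.≤_) (-[p-q]≡q-p p q) (ℚ.neg-antimono-≤ p-q≤0)

∣p∣<∣q∣+ε : ∀ p q {ε} → ℚ.∣ p ℚ.- q ∣ ℚ.< ε → ℚ.∣ p ∣ ℚ.< ℚ.∣ q ∣ ℚ.+ ε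
∣p∣<∣q∣+ε p q {ε} lt = begin-strict
  ℚ.∣ p ∣                          ≡⟨ cong ℚ.∣_∣ (cancel-mid p q) ⟩
  ℚ.∣ q ℚ.+ (p ℚ.- q) ∣            ≤⟨ ℚ.∣p+q∣≤∣p∣+∣q∣ q (p ℚ.- q) ⟩
  ℚ.∣ q ∣ ℚ.+ ℚ.∣ p ℚ.- q ∣        <⟨ ℚ.+-monoʳ-< ℚ.∣ q ∣ {ℚ.∣ p ℚ.- q ∣} {ε} lt ⟩
  ℚ.∣ q ∣ ℚ.+ ε                    ∎
  where open ℚ.≤-Reasoning

p≤r+ε : ∀ p q r {η ε} → η ℚ.+ η ≡ ε → p ℚ.≤ q ℚ.+ η → q ℚ.≤ r ℚ.+ η → p ℚ.≤ r ℚ.+ ε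
p≤r+ε p q r {η} refl p≤ q≤ = begin
  p                        ≤⟨ p≤ ⟩
  q ℚ.+ η                  ≤⟨ ℚ.+-monoˡ-≤ η {q} {r ℚ.+ η} q≤ ⟩
  r ℚ.+ η ℚ.+ η            ≡⟨ ℚ.+-assoc r η η ⟩
  r ℚ.+ (η ℚ.+ η)          ∎
  where open ℚ.≤-Reasoning

p<s+ε : ∀ p q r s {δ η ε} → δ ℚ.+ δ ≡ η → η ℚ.+ η ≡ ε →
        p ℚ.< q ℚ.+ δ → q ℚ.≤ r ℚ.+ η → r ℚ.< s ℚ.+ δ → p ℚ.< s ℚ.+ ε
p<s+ε p q r s {δ} {η} {ε} δ+δ≡η η+η≡ε p<q+δ q≤r+η r<s+δ = begin-strict
  p                              <⟨ p<q+δ ⟩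
  q ℚ.+ δ                        ≤⟨ ℚ.+-monoˡ-≤ δ {q} {r ℚ.+ η} q≤r+η ⟩
  r ℚ.+ η ℚ.+ δ                  <⟨ ℚ.+-monoˡ-< δ {r ℚ.+ η} {s ℚ.+ δ ℚ.+ η} (ℚ.+-monoˡ-< η {r} {s ℚ.+ δ} r<s+δ) ⟩
  s ℚ.+ δ ℚ.+ η ℚ.+ δ            ≡⟨ regroup s δ η ⟩
  s ℚ.+ ((δ ℚ.+ δ) ℚ.+ η)        ≡⟨ cong (s ℚ.+_) (trans (cong (ℚ._+ η) δ+δ≡η) η+η≡ε) ⟩
  s ℚ.+ ε                        ∎
  where
  open ℚ.≤-Reasoning
  open ℚ.+-*-Solver
  regroup : ∀ s δ η → s ℚ.+ δ ℚ.+ η ℚ.+ δ ≡ s ℚ.+ ((δ ℚ.+ δ) ℚ.+ η)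
  regroup = solve 3 (λ s δ η → s :+ δ :+ η :+ δ := s :+ ((δ :+ δ) :+ η)) refl

p<s+η : ∀ p q r s {δ η} → δ ℚ.+ δ ≡ η → p ℚ.< q ℚ.+ δ → q ℚ.< r → r ℚ.< s ℚ.+ δ → p ℚ.< s ℚ.+ η
p<s+η p q r s {δ} {η} δ+δ≡η p<q+δ q<r r<s+δ = begin-strict
  p                        <⟨ p<q+δ ⟩
  q ℚ.+ δ                  <⟨ ℚ.+-monoˡ-< δ {q} {r} q<r ⟩
  r ℚ.+ δ                  <⟨ ℚ.+-monoˡ-< δ {r} {s ℚ.+ δ} r<s+δ ⟩
  s ℚ.+ δ ℚ.+ δ            ≡⟨ trans (ℚ.+-assoc s δ δ) (cong (s ℚ.+_) δ+δ≡η) ⟩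
  s ℚ.+ η                  ∎
  where open ℚ.≤-Reasoning

∣p∣<η : ∀ p q {η δ} → 0ℚ ℚ.< η → δ ℚ.< ℚ.∣ q ∣ → ℚ.∣ p ℚ.* q ∣ ℚ.< η ℚ.* δ → ℚ.∣ p ∣ ℚ.< η
∣p∣<η p q {η} {δ} 0<η δ<∣q∣ ∣pq∣<ηδ = ℚ.≰⇒> λ η≤∣p∣ → ℚ.<-irrefl refl (begin-strict
  η ℚ.* δ                  <⟨ ℚ.*-monoʳ-<-pos η {{ℚ.positive 0<η}} {δ} {ℚ.∣ q ∣} δ<∣q∣ ⟩
  η ℚ.* ℚ.∣ q ∣            ≤⟨ ℚ.*-monoʳ-≤-nonNeg ℚ.∣ q ∣ {{ℚ.∣-∣-nonNeg q}} {η} {ℚ.∣ p ∣} η≤∣p∣ ⟩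
  ℚ.∣ p ∣ ℚ.* ℚ.∣ q ∣      ≡⟨ ℚ.∣p*q∣≡∣p∣*∣q∣ p q ⟨
  ℚ.∣ p ℚ.* q ∣            <⟨ ∣pq∣<ηδ ⟩
  η ℚ.* δ                  ∎)
  where open ℚ.≤-Reasoning

-- x ≈ y unfolds to Null (λ n → seq x n ℚ.- seq y n).
Null : (ℕ → ℚ) → Set
Null f = ∀ ε → 0ℚ ℚ.< ε → Eventually (λ n → ℚ.∣ f n ∣ ℚ.< ε)

Null-cong : ∀ {f g} → (∀ n → f n ≡ g n) → Null f → Null g
Null-cong f≗g null ε 0<ε with null ε 0<ε
... | N , p = N , λ n N≤n → subst (λ z → ℚ.∣ z ∣ ℚ.< ε) (f≗g n) (p n N≤n)

∣p+q∣<ε : ∀ p q {η ε} → η ℚ.+ η ≡ ε → ℚ.∣ p ∣ ℚ.< η → ℚ.∣ q ∣ ℚ.< η → ℚ.∣ p ℚ.+ q ∣ ℚ.< ε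
∣p+q∣<ε p q {η} {ε} η+η≡ε p<η q<η = subst (ℚ.∣ p ℚ.+ q ∣ ℚ.<_) η+η≡ε
  (ℚ.≤-<-trans {ℚ.∣ p ℚ.+ q ∣} {ℚ.∣ p ∣ ℚ.+ ℚ.∣ q ∣} {η ℚ.+ η} (ℚ.∣p+q∣≤∣p∣+∣q∣ p q)
    (ℚ.+-mono-< {ℚ.∣ p ∣} {η} {ℚ.∣ q ∣} {η} p<η q<η))

Null-+ : ∀ {f g} → Null f → Null g → Null (λ n → f n ℚ.+ g n)
Null-+ {f} {g} nf ng ε 0<ε = let η , 0<η , _ , η+η≡ε = half ε 0<ε in
  eventually₂ (λ n → ∣p+q∣<ε (f n) (g n) η+η≡ε) (nf η 0<η) (ng η 0<η)

abstract
  bounded : ∀ x → ∃[ K ] (0ℚ ℚ.< K × Eventually (λ n → ℚ.∣ seq x n ∣ ℚ.≤ K))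
  bounded x with cauchy x 1ℚ (ℚ.positive⁻¹ 1ℚ)
  ... | N , close = ℚ.∣ a ∣ ℚ.+ 1ℚ , ℚ.+-mono-≤-< (ℚ.0≤∣p∣ a) (ℚ.positive⁻¹ 1ℚ) , N , λ n N≤n → begin
    ℚ.∣ seq x n ∣                          ≡⟨ cong ℚ.∣_∣ (cancel-mid (seq x n) a) ⟩
    ℚ.∣ a ℚ.+ (seq x n ℚ.- a) ∣            ≤⟨ ℚ.∣p+q∣≤∣p∣+∣q∣ a (seq x n ℚ.- a) ⟩
    ℚ.∣ a ∣ ℚ.+ ℚ.∣ seq x n ℚ.- a ∣        ≤⟨ ℚ.+-monoʳ-≤ ℚ.∣ a ∣ (ℚ.<⇒≤ (close n N N≤n ≤-refl)) ⟩
    ℚ.∣ a ∣ ℚ.+ 1ℚ                         ∎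
    where
    open ℚ.≤-Reasoning
    a : ℚ
    a = seq x N

abstract
  divide : ∀ K ε → 0ℚ ℚ.< K → 0ℚ ℚ.< ε → ∃[ δ ] (0ℚ ℚ.< δ × K ℚ.* δ ≡ ε)
  divide K ε 0<K 0<ε = 1/K ℚ.* ε ,
    ℚ.positive⁻¹ (1/K ℚ.* ε) {{ℚ.pos*pos⇒pos 1/K {{ℚ.1/pos⇒pos K {{ℚ.positive 0<K}}}} ε {{ℚ.positive 0<ε}}}} ,
    trans (sym (ℚ.*-assoc K 1/K ε)) (trans (cong (ℚ._* ε) (ℚ.*-inverseʳ K {{K≢0}})) (ℚ.*-identityˡ ε))
    where
    K≢0 : ℚ.NonZero K
    K≢0 = ℚ.pos⇒nonZero K {{ℚ.positive 0<K}}
    1/K : ℚ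
    1/K = (ℚ.1/ K) {{K≢0}}

∣p*q∣<K*δ : ∀ p q {K δ} → 0ℚ ℚ.< K → ℚ.∣ p ∣ ℚ.≤ K → ℚ.∣ q ∣ ℚ.< δ → ℚ.∣ p ℚ.* q ∣ ℚ.< K ℚ.* δ
∣p*q∣<K*δ p q {K} {δ} 0<K p≤K q<δ = subst (ℚ._< K ℚ.* δ) (sym (ℚ.∣p*q∣≡∣p∣*∣q∣ p q))
  (ℚ.≤-<-trans
    (ℚ.*-monoʳ-≤-nonNeg ℚ.∣ q ∣ {{ℚ.∣-∣-nonNeg q}} p≤K)
    (ℚ.*-monoʳ-<-pos K {{ℚ.positive 0<K}} q<δ))

Null-* : ∀ x {f} → Null f → Null (λ n → seq x n ℚ.* f n)
Null-* x {f} nf ε 0<ε =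
  let K , 0<K , bnd   = bounded x
      δ , 0<δ , Kδ≡ε = divide K ε 0<K 0<ε
  in eventually₂ {λ n → ℚ.∣ seq x n ∣ ℚ.≤ K} {λ n → ℚ.∣ f n ∣ ℚ.< δ}
       (λ n p q → subst (ℚ.∣ seq x n ℚ.* f n ∣ ℚ.<_) Kδ≡ε (∣p*q∣<K*δ (seq x n) (f n) {K} {δ} 0<K p q))
       bnd (nf δ 0<δ)

≈-pointwise : ∀ {x y} → (∀ n → seq x n ≡ seq y n) → x ≈ y
≈-pointwise {x} {y} eq ε 0<ε = always λ n → subst (λ z → ℚ.∣ z ∣ ℚ.< ε)
  (sym (trans (cong (ℚ._- seq y n) (eq n)) (ℚ.+-inverseʳ (seq y n)))) 0<ε

const : ℚ → ℝ
const q .seq _ = q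
const q .cauchy ε 0<ε = 0 , λ _ _ _ _ → subst (λ z → ℚ.∣ z ∣ ℚ.< ε) (sym (ℚ.+-inverseʳ q)) 0<ε

1ℝ : ℝ
1ℝ = const 1ℚ

-- _≈_ unfolds to a statement on rationals, from which the two real numbers cannot be
-- recovered by unification; _≃_ does not unfold.
infix 4 _≃_

data _≃_ (x y : ℝ) : Set where
  ⌊_⌋ : x ≈ y → x ≃ y

infix 8 -_
infixl 6 _-_

-_ : ℝ → ℝ
- x = const (ℚ.- 1ℚ) ℝ.* x

_-_ : ℝ → ℝ → ℝ
x - y = x ℝ.+ - y

module _ where
  open ℚ.+-*-Solver

  ≈-refl : ∀ {x} → x ≈ x
  ≈-refl {x} = ≈-pointwise {x} {x} (λ _ → refl)

  ≈-sym : ∀ {x y} → x ≈ y → y ≈ x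
  ≈-sym {x} {y} x≈y ε 0<ε with x≈y ε 0<ε
  ... | N , p = N , λ n N≤n → subst (ℚ._< ε) (∣p-q∣≡∣q-p∣ (seq x n) (seq y n)) (p n N≤n)

  ≈-trans : ∀ {x y z} → x ≈ y → y ≈ z → x ≈ z
  ≈-trans {x} {y} {z} x≈y y≈z = Null-cong
    (λ n → telescope (seq x n) (seq y n) (seq z n)) (Null-+ x≈y y≈z)
    where
    telescope : ∀ a b c → (a ℚ.- b) ℚ.+ (b ℚ.- c) ≡ a ℚ.- c
    telescope = solve 3 (λ a b c → (a :- b) :+ (b :- c) := a :- c) refl

  +-cong : ∀ {x y u v} → x ≈ y → u ≈ v → x ℝ.+ u ≈ y ℝ.+ v
  +-cong {x} {y} {u} {v} x≈y u≈v = Null-cong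
    (λ n → regroup (seq x n) (seq y n) (seq u n) (seq v n)) (Null-+ x≈y u≈v)
    where
    regroup : ∀ a b c d → (a ℚ.- b) ℚ.+ (c ℚ.- d) ≡ (a ℚ.+ c) ℚ.- (b ℚ.+ d)
    regroup = solve 4 (λ a b c d → (a :- b) :+ (c :- d) := (a :+ c) :- (b :+ d)) refl

  *-cong : ∀ {x y u v} → x ≈ y → u ≈ v → x ℝ.* u ≈ y ℝ.* v
  *-cong {x} {y} {u} {v} x≈y u≈v = Null-cong
    (λ n → regroup (seq x n) (seq y n) (seq u n) (seq v n)) (Null-+ (Null-* u x≈y) (Null-* y u≈v))
    where
    regroup : ∀ a b c d → c ℚ.* (a ℚ.- b) ℚ.+ b ℚ.* (c ℚ.- d) ≡ a ℚ.* c ℚ.- b ℚ.* d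
    regroup = solve 4 (λ a b c d → c :* (a :- b) :+ b :* (c :- d) := a :* c :- b :* d) refl

  ℝ-isCommutativeRing : IsCommutativeRing _≃_ ℝ._+_ ℝ._*_ -_ 0ℝ 1ℝ
  ℝ-isCommutativeRing = record
    { isRing = record
      { +-isAbelianGroup = record
        { isGroup = record
          { isMonoid = record
            { isSemigroup = record
              { isMagma = record
                { isEquivalence = record
                  { refl  = λ {x} → ⌊ ≈-refl {x} ⌋
                  ; sym   = λ { {x} {y} ⌊ p ⌋ → ⌊ ≈-sym {x} {y} p ⌋ }
                  ; trans = λ { {x} {y} {z} ⌊ p ⌋ ⌊ q ⌋ → ⌊ ≈-trans {x} {y} {z} p q ⌋ }
                  }
                ; ∙-cong = λ { {x} {y} {u} {v} ⌊ p ⌋ ⌊ q ⌋ → ⌊ +-cong {x} {y} {u} {v} p q ⌋ }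
                }
              ; assoc = λ x y z → pointwise (λ n → ℚ.+-assoc (seq x n) (seq y n) (seq z n))
              }
            ; identity = (λ x → pointwise (λ n → ℚ.+-identityˡ (seq x n)))
                       , (λ x → pointwise (λ n → ℚ.+-identityʳ (seq x n)))
            }
          ; inverse = (λ x → pointwise (λ n → inverseˡ (seq x n)))
                    , (λ x → pointwise (λ n → inverseʳ (seq x n)))
          ; ⁻¹-cong = λ { {x} {y} ⌊ p ⌋ →
              ⌊ *-cong {const (ℚ.- 1ℚ)} {const (ℚ.- 1ℚ)} {x} {y} (≈-refl {const (ℚ.- 1ℚ)}) p ⌋ }
          }
        ; comm = λ x y → pointwise (λ n → ℚ.+-comm (seq x n) (seq y n))
        }
      ; *-cong     = λ { {x} {y} {u} {v} ⌊ p ⌋ ⌊ q ⌋ → ⌊ *-cong {x} {y} {u} {v} p q ⌋ }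
      ; *-assoc    = λ x y z → pointwise (λ n → ℚ.*-assoc (seq x n) (seq y n) (seq z n))
      ; *-identity = (λ x → pointwise (λ n → ℚ.*-identityˡ (seq x n)))
                   , (λ x → pointwise (λ n → ℚ.*-identityʳ (seq x n)))
      ; distrib    = (λ x y z → pointwise (λ n → ℚ.*-distribˡ-+ (seq x n) (seq y n) (seq z n)))
                   , (λ x y z → pointwise (λ n → ℚ.*-distribʳ-+ (seq x n) (seq y n) (seq z n)))
      }
    ; *-comm = λ x y → pointwise (λ n → ℚ.*-comm (seq x n) (seq y n))
    }
    where
    pointwise : ∀ {x y} → (∀ n → seq x n ≡ seq y n) → x ≃ y
    pointwise {x} {y} eq = ⌊ ≈-pointwise {x} {y} eq ⌋
    inverseˡ : ∀ a → (ℚ.- 1ℚ) ℚ.* a ℚ.+ a ≡ 0ℚ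
    inverseˡ = solve 1 (λ a → con (ℚ.- 1ℚ) :* a :+ a := con 0ℚ) refl
    inverseʳ : ∀ a → a ℚ.+ (ℚ.- 1ℚ) ℚ.* a ≡ 0ℚ
    inverseʳ = solve 1 (λ a → a :+ con (ℚ.- 1ℚ) :* a := con 0ℚ) refl

ℝ-commutativeRing : CommutativeRing 0ℓ 0ℓ
ℝ-commutativeRing = record { isCommutativeRing = ℝ-isCommutativeRing }

1≉0 : ¬ 1ℝ ≈ 0ℝ
1≉0 1≈0 = eventually-⊥ (λ _ → ℚ.<-irrefl refl) (1≈0 1ℚ (ℚ.positive⁻¹ 1ℚ))

-- The constructive substitute for deciding x = 0. With η = ε/2, δ = ε/4 and an index N after which
-- the sequence varies by less than δ, the one rational comparison of its absolute value at N with η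
-- settles all later terms: they stay below η + δ < ε or above η - δ = δ.
located : ∀ x ε → 0ℚ ℚ.< ε →
  Eventually (λ n → ℚ.∣ seq x n ∣ ℚ.< ε) ⊎
  (∃[ δ ] (0ℚ ℚ.< δ × Eventually (λ n → δ ℚ.< ℚ.∣ seq x n ∣)))
located x ε 0<ε = scale (half ε 0<ε)
  where
  scale : ∃[ η ] (0ℚ ℚ.< η × η ℚ.< ε × η ℚ.+ η ≡ ε) → _
  scale (η , 0<η , _ , η+η≡ε) = scale′ (half η 0<η)
    where
    scale′ : ∃[ δ ] (0ℚ ℚ.< δ × δ ℚ.< η × δ ℚ.+ δ ≡ η) → _
    scale′ (δ , 0<δ , δ<η , δ+δ≡η) = cases (ℚ.∣ seq x N ∣ ℚ.<? η)
      where
      N : ℕ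
      N = proj₁ (cauchy x δ 0<δ)
      close : ∀ m n → N ≤ m → N ≤ n → ℚ.∣ seq x m ∣ ℚ.< ℚ.∣ seq x n ∣ ℚ.+ δ
      close m n N≤m N≤n = ∣p∣<∣q∣+ε (seq x m) (seq x n) (proj₂ (cauchy x δ 0<δ) m n N≤m N≤n)
      cases : Dec (ℚ.∣ seq x N ∣ ℚ.< η) → _
      cases (yes small) = inj₁ (N , λ n N≤n → subst (ℚ.∣ seq x n ∣ ℚ.<_) η+η≡ε
        (ℚ.<-trans {ℚ.∣ seq x n ∣} {ℚ.∣ seq x N ∣ ℚ.+ δ} {η ℚ.+ η} (close n N N≤n ≤-refl)
          (ℚ.+-mono-< {ℚ.∣ seq x N ∣} {η} {δ} {η} small δ<η)))
      cases (no large) = inj₂ (δ , 0<δ , N , λ n N≤n → ℚ.≰⇒> λ ∣xₙ∣≤δ → large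
        (subst (ℚ.∣ seq x N ∣ ℚ.<_) δ+δ≡η
          (ℚ.<-≤-trans {ℚ.∣ seq x N ∣} {ℚ.∣ seq x n ∣ ℚ.+ δ} {δ ℚ.+ δ} (close N n ≤-refl N≤n)
            (ℚ.+-monoˡ-≤ δ {ℚ.∣ seq x n ∣} {δ} ∣xₙ∣≤δ))))

≈0-intro : ∀ x → Null (seq x) → x ≈ 0ℝ
≈0-intro x = Null-cong (λ n → sym (ℚ.+-identityʳ (seq x n)))

≈0-elim : ∀ x → x ≈ 0ℝ → Null (seq x)
≈0-elim x = Null-cong (λ n → ℚ.+-identityʳ (seq x n))

-- For each ε, the second alternative of `located` would bound x away from 0 and refute `x ≈ 0ℝ`, so
-- the first one holds.
≈0-stable : ∀ x → ¬ ¬ x ≈ 0ℝ → x ≈ 0ℝ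
≈0-stable x ¬¬x≈0 = ≈0-intro x null
  where
  null : Null (seq x)
  null ε 0<ε with located x ε 0<ε
  ... | inj₁ small = small
  ... | inj₂ (δ , 0<δ , large) = contradiction
    (λ x≈0 → eventually-⊥ {λ _ → ⊥} (λ _ ())
      (eventually₂ {λ n → δ ℚ.< ℚ.∣ seq x n ∣} {λ n → ℚ.∣ seq x n ∣ ℚ.< δ}
        (λ n p q → ℚ.<-asym p q) large (≈0-elim x x≈0 δ 0<δ)))
    ¬¬x≈0

-- If y stayed above δ in absolute value, then a product below η δ would force x below η, for every
-- η, and x would be 0.
*-domain : ∀ x y → ¬ x ≈ 0ℝ → x ℝ.* y ≈ 0ℝ → y ≈ 0ℝ
*-domain x y x≉0 xy≈0 = ≈0-intro y case
  where
  case : Null (seq y)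
  case ε 0<ε with located y ε 0<ε
  ... | inj₁ small = small
  ... | inj₂ (δ , 0<δ , large) = contradiction (≈0-intro x null) x≉0
    where
    null : Null (seq x)
    null η 0<η = eventually₂ {λ n → δ ℚ.< ℚ.∣ seq y n ∣} {λ n → ℚ.∣ seq x n ℚ.* seq y n ∣ ℚ.< η ℚ.* δ}
      (λ n p q → ∣p∣<η (seq x n) (seq y n) 0<η p q) large
      (≈0-elim (x ℝ.* y) xy≈0 (η ℚ.* δ) (ℚ.positive⁻¹ (η ℚ.* δ) {{ℚ.pos*pos⇒pos η {{ℚ.positive 0<η}} δ {{ℚ.positive 0<δ}}}}))

≤ℝ-refl : ∀ {x} → x ℝ.≤ x
≤ℝ-refl {x} ε 0<ε = always λ n → ℚ.<⇒≤ (p<p+ε (seq x n) {ε} 0<ε)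

≤ℝ-trans : ∀ {x y z} → x ℝ.≤ y → y ℝ.≤ z → x ℝ.≤ z
≤ℝ-trans {x} {y} {z} x≤y y≤z ε 0<ε =
  let η , 0<η , _ , η+η≡ε = half ε 0<ε in
  eventually₂ {λ n → seq x n ℚ.≤ seq y n ℚ.+ η} {λ n → seq y n ℚ.≤ seq z n ℚ.+ η}
    (λ n → p≤r+ε (seq x n) (seq y n) (seq z n) {η} η+η≡ε) (x≤y η 0<η) (y≤z η 0<η)

≤ℝ-antisym : ∀ {x y} → x ℝ.≤ y → y ℝ.≤ x → x ≈ y
≤ℝ-antisym {x} {y} x≤y y≤x ε 0<ε =
  let η , 0<η , η<ε , _ = half ε 0<ε in
  eventually₂ {λ n → seq x n ℚ.≤ seq y n ℚ.+ η} {λ n → seq y n ℚ.≤ seq x n ℚ.+ η}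
    (λ n → ∣p-q∣<ε (seq x n) (seq y n) {η} η<ε) (x≤y η 0<η) (y≤x η 0<η)

x-y≈0⇒x≤y : ∀ x y → x - y ≈ 0ℝ → x ℝ.≤ y
x-y≈0⇒x≤y x y x-y≈0 ε 0<ε =
  let N , p = Null-cong {λ n → seq (x - y) n ℚ.- 0ℚ} {λ n → seq x n ℚ.- seq y n}
                (λ n → minus (seq x n) (seq y n)) x-y≈0 ε 0<ε
  in N , λ n N≤n → ℚ.<⇒≤ (∣p-q∣<ε⇒p<q+ε (seq x n) (seq y n) {ε} (p n N≤n))
  where
  open ℚ.+-*-Solver
  minus : ∀ a b → a ℚ.+ (ℚ.- 1ℚ) ℚ.* b ℚ.- 0ℚ ≡ a ℚ.- b
  minus = solve 2 (λ a b → a :+ con (ℚ.- 1ℚ) :* b :- con 0ℚ := a :- b) refl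

-- One rational comparison at an index K after which both sequences vary by less than ε/4: if y is
-- at most x + ε/2 there, y stays at most x + ε; otherwise x is at most y from K on, against the
-- assumption.
≰ℝ⇒≥ℝ : ∀ {x y} → ¬ x ℝ.≤ y → y ℝ.≤ x
≰ℝ⇒≥ℝ {x} {y} x≰y ε 0<ε = scale (half ε 0<ε)
  where
  scale : ∃[ η ] (0ℚ ℚ.< η × η ℚ.< ε × η ℚ.+ η ≡ ε) → _
  scale (η , 0<η , _ , η+η≡ε) = scale′ (half η 0<η)
    where
    scale′ : ∃[ δ ] (0ℚ ℚ.< δ × δ ℚ.< η × δ ℚ.+ δ ≡ η) → _
    scale′ (δ , 0<δ , _ , δ+δ≡η) = cases (seq y K ℚ.≤? seq x K ℚ.+ η)
      where
      M N K : ℕ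
      M = proj₁ (cauchy x δ 0<δ)
      N = proj₁ (cauchy y δ 0<δ)
      K = M ℕ.⊔ N
      closeₓ : ∀ m n → K ≤ m → K ≤ n → seq x m ℚ.< seq x n ℚ.+ δ
      closeₓ m n p q = ∣p-q∣<ε⇒p<q+ε (seq x m) (seq x n) {δ}
        (proj₂ (cauchy x δ 0<δ) m n (m⊔n≤o⇒m≤o M N p) (m⊔n≤o⇒m≤o M N q))
      closeᵧ : ∀ m n → K ≤ m → K ≤ n → seq y m ℚ.< seq y n ℚ.+ δ
      closeᵧ m n p q = ∣p-q∣<ε⇒p<q+ε (seq y m) (seq y n) {δ}
        (proj₂ (cauchy y δ 0<δ) m n (m⊔n≤o⇒n≤o M N p) (m⊔n≤o⇒n≤o M N q))
      cases : Dec (seq y K ℚ.≤ seq x K ℚ.+ η) → _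
      cases (yes p) = K , λ n K≤n → ℚ.<⇒≤
        (p<s+ε (seq y n) (seq y K) (seq x K) (seq x n) {δ} δ+δ≡η η+η≡ε
          (closeᵧ n K K≤n ≤-refl) p (closeₓ K n ≤-refl K≤n))
      cases (no ¬p) = contradiction
        (λ ε′ 0<ε′ → K , λ n K≤n → ℚ.<⇒≤ (ℚ.≤-<-trans {seq x n} {seq y n} {seq y n ℚ.+ ε′}
          (ℚ.≮⇒≥ λ y<x → ¬p (ℚ.<⇒≤
            (p<s+η (seq y K) (seq y n) (seq x n) (seq x K) {δ} δ+δ≡η
              (closeᵧ K n ≤-refl K≤n) y<x (closeₓ n K K≤n ≤-refl))))
          (p<p+ε (seq y n) {ε′} 0<ε′)))
        x≰y

-- From boxes to words

unwrap : ∀ {x y} → x ≃ y → x ≈ y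
unwrap ⌊ p ⌋ = p

ℝ-isStableDomain : IsStableDomain ℝ-commutativeRing
ℝ-isStableDomain = record
  { stable     = λ x ¬¬x≃0 → ⌊ ≈0-stable x (λ x≉0 → ¬¬x≃0 (λ { ⌊ p ⌋ → x≉0 p })) ⌋
  ; domain     = λ { x y x≄0 ⌊ xy≈0 ⌋ → ⌊ *-domain x y (λ p → x≄0 ⌊ p ⌋) xy≈0 ⌋ }
  ; nontrivial = λ { ⌊ p ⌋ → 1≉0 p }
  }

module ℝ-LinearAlgebra = LinearAlgebra ℝ-isStableDomain
open ℝ-LinearAlgebra using (Independent; Contains; contains-≤; box-contains; flat-¬contains)

independent⁺ : ∀ {d m} (p : Vector (ℝ^ d) m) → AffinelyIndependent p → Independent p
independent⁺ p independent c ⌊ ∑c≈0 ⌋ ∑cp≃0 j = ⌊ independent c ∑c≈0 (λ i → unwrap (∑cp≃0 i)) j ⌋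

independent⁻ : ∀ {d m} (p : Vector (ℝ^ d) m) → Independent p → AffinelyIndependent p
independent⁻ p independent c ∑c≈0 ∑cp≈0 j = unwrap (independent c ⌊ ∑c≈0 ⌋ (λ i → ⌊ ∑cp≈0 i ⌋) j)

contains⁺ : ∀ {d m} {S : Pred (ℝ^ d) 0ℓ} → ContainsIndependent m S → Contains m S
contains⁺ (p , p∈S , independent) = p , p∈S , independent⁺ p independent

contains⁻ : ∀ {d m} {S : Pred (ℝ^ d) 0ℓ} → Contains m S → ContainsIndependent m S
contains⁻ (p , p∈S , independent) = p , p∈S , independent⁻ p independent

-- This is what lets finitely many undecidable comparisons of reals be taken as decided
-- simultaneously, as long as the goal is stable.
¬¬-Fin : ∀ {n} {P : Fin n → Set} → (∀ i → ¬ ¬ P i) → ¬ ¬ (∀ i → P i)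
¬¬-Fin {zero}  ¬¬P k = k λ ()
¬¬-Fin {suc n} ¬¬P k = ¬¬P zero λ p₀ → ¬¬-Fin (¬¬P ∘ suc) λ ps → k λ { zero → p₀ ; (suc i) → ps i }

agreeing : ∀ {d} (f g : Fin d → Maybe Bool) →
  ∃[ free ] ((∀ i → i ∈ free ⊎ conflict (f i) (g i) ≡ true) × length free + dist (tabulate f) (tabulate g) ≡ d)
agreeing {zero}  f g = List.[] , (λ ()) , refl
agreeing {suc d} f g with agreeing (f ∘ suc) (g ∘ suc) | conflict (f zero) (g zero) in eq
... | free , cover , size | true  = List.map suc free ,
  (λ { zero → inj₂ eq ; (suc i) → Sum.map₁ (∈-map⁺ suc) (cover i) }) ,
  trans (+-suc _ _) (cong suc (trans (cong (_+ dist (tabulate (f ∘ suc)) (tabulate (g ∘ suc))) (List.length-map suc free)) size))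
... | free , cover , size | false = zero List.∷ List.map suc free ,
  (λ { zero → inj₁ (here refl) ; (suc i) → Sum.map₁ (there ∘ ∈-map⁺ suc) (cover i) }) ,
  cong suc (trans (cong (_+ dist (tabulate (f ∘ suc)) (tabulate (g ∘ suc))) (List.length-map suc free)) size)

dist≡0⇒¬conflict : ∀ {d} (f g : Fin d → Maybe Bool) → dist (tabulate f) (tabulate g) ≡ 0 →
                   ∀ i → conflict (f i) (g i) ≡ false
dist≡0⇒¬conflict {suc d} f g eq i with conflict (f zero) (g zero) in head
dist≡0⇒¬conflict {suc d} f g eq zero    | false = head
dist≡0⇒¬conflict {suc d} f g eq (suc i) | false = dist≡0⇒¬conflict (f ∘ suc) (g ∘ suc) eq i

module _ {k d N} {F : Vector (Box d) N} (neighborly : IsNeighborly k F) where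

  open IsNeighborly neighborly

  -- Sides of members of the family always meet (`common`), so the inequality means that the upper
  -- end of one coincides with the lower end of the other.
  Below : Fin d → Fin N → Fin N → Set
  Below i a b = upper (F a i) ℝ.≤ lower (F b i)

  common : ∀ i a b → lower (F a i) ℝ.≤ upper (F b i)
  common i a b with a Fin.≟ b
  ... | yes refl = lower≤upper (F a i)
  ... | no  a≢b  =
    let _ , _ , _ , (p , p∈ , _) , _ = intersections a b a≢b
    in ≤ℝ-trans {lower (F a i)} {p zero i} {upper (F b i)} (proj₁ (proj₁ (p∈ zero) i)) (proj₂ (proj₂ (p∈ zero) i))

  squeeze : ∀ i a b {x y} → Below i a b → lower (F b i) ℝ.≤ x → y ℝ.≤ upper (F a i) → y ℝ.≤ x
  squeeze i a b {x} {y} below l≤x y≤u = ≤ℝ-trans {y} {upper (F a i)} {x} y≤u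
    (≤ℝ-trans {upper (F a i)} {lower (F b i)} {x} below l≤x)

  below⇒≃ : ∀ i a b {x y} → Below i a b →
    lower (F b i) ℝ.≤ x → x ℝ.≤ upper (F a i) → lower (F b i) ℝ.≤ y → y ℝ.≤ upper (F a i) → x ≃ y
  below⇒≃ i a b {x} {y} below l≤x x≤u l≤y y≤u =
    ⌊ ≤ℝ-antisym {x} {y} (squeeze i a b {y} {x} below l≤y x≤u) (squeeze i a b {x} {y} below l≤x y≤u) ⌋

  -- A side reduced to a point would fix coordinate i on the whole box and leave d - 1 free
  -- coordinates, too few for d + 1 independent points.
  ¬below-self : ∀ i a → ¬ Below i a a
  ¬below-self i a below = impossible {S = ⟦ F a ⟧} i (λ x y x∈ y∈ →
    below⇒≃ i a a {x i} {y i} below (proj₁ (x∈ i)) (proj₂ (x∈ i)) (proj₁ (y∈ i)) (proj₂ (y∈ i))) (contains⁺ {S = ⟦ F a ⟧} (proj₁ (fullDimensional a)))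
    where
    impossible : ∀ {d} {S : Pred (ℝ^ d) 0ℓ} i → (∀ x y → S x → S y → x i ≃ y i) → ¬ Contains (suc d) S
    impossible {suc d} {S} i fixed = flat-¬contains {S = S} (List.map (punchIn i) (List.allFin d)) cover
      (s≤s (≤-reflexive (trans (List.length-map (punchIn i) (List.allFin d)) (List.length-tabulate {n = d} (λ j → j)))))
      where
      cover : ∀ j → j ∈ List.map (punchIn i) (List.allFin d) ⊎ (∀ x y → S x → S y → x j ≃ y j)
      cover j with i Fin.≟ j
      ... | yes refl = inj₂ fixed
      ... | no  i≢j  = inj₁ (subst (_∈ List.map (punchIn i) (List.allFin d)) (Fin.punchIn-punchOut i≢j)
                               (∈-map⁺ (punchIn i) (∈-allFin (punchOut i≢j))))

  -- The sides of a and c would be separated by the nondegenerate side of b, although they meet.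
  ¬below-both : ∀ i a b c → Below i a b → ¬ Below i b c
  ¬below-both i a b c below₁ below₂ = ¬below-self i b
    (≤ℝ-trans {upper (F b i)} {lower (F c i)} {lower (F b i)} below₂
      (≤ℝ-trans {lower (F c i)} {upper (F a i)} {lower (F b i)} (common i c a) below₁))

  -- A nondegenerate intersection of two boxes is a box of dimension d.
  someBelow : ∀ a b → a ≢ b → ¬ (∀ i → ¬ Below i a b × ¬ Below i b a)
  someBelow a b a≢b apart =
    let _ , _ , m<d , _ , ¬m+2 = intersections a b a≢b
    in ¬¬-Fin sides λ side →
         ¬m+2 (contains⁻ {S = ⟦ F a ⟧ ∩ ⟦ F b ⟧} (contains-≤ {S = ⟦ F a ⟧ ∩ ⟦ F b ⟧} (s≤s m<d)
           (box-contains {S = ⟦ F a ⟧ ∩ ⟦ F b ⟧} (λ i → proj₁ (side i)) (λ i → proj₁ (proj₂ (side i)))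
             (λ i U-L≃0 → proj₁ (proj₂ (proj₂ (side i)))
               (x-y≈0⇒x≤y (proj₁ (proj₂ (side i))) (proj₁ (side i)) (unwrap U-L≃0)))
             (λ x corner → (λ i → proj₁ (proj₂ (proj₂ (proj₂ (side i))) (x i) (corner i)))
                         , (λ i → proj₂ (proj₂ (proj₂ (proj₂ (side i))) (x i) (corner i)))))))
    where
    Inside : Fin d → Fin N → ℝ → Set
    Inside i c x = lower (F c i) ℝ.≤ x × x ℝ.≤ upper (F c i)
    Side : Fin d → Set
    Side i = ∃[ L ] ∃[ U ] (¬ U ℝ.≤ L × (∀ x → x ≡ L ⊎ x ≡ U → Inside i a x × Inside i b x))
    side : ∀ i x y → ¬ Below i y x → (∀ c → c ≡ a ⊎ c ≡ b → lower (F c i) ℝ.≤ lower (F x i)) →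
           (∀ c → c ≡ a ⊎ c ≡ b → upper (F y i) ℝ.≤ upper (F c i)) → Side i
    side i x y ¬below L-max U-min = L , U , ¬below , λ z end → enclosed z end a (inj₁ refl) , enclosed z end b (inj₂ refl)
      where
      L = lower (F x i)
      U = upper (F y i)
      enclosed : ∀ z → z ≡ L ⊎ z ≡ U → ∀ c → c ≡ a ⊎ c ≡ b → Inside i c z
      enclosed z (inj₁ refl) c c∈ = L-max c c∈ , common i x c
      enclosed z (inj₂ refl) c c∈ = common i c y , U-min c c∈
    sides : ∀ i → ¬ ¬ Side i
    sides i k =
      -- The ends of the intersection are the larger lower end and the smaller upper end; which of a
      -- and b supplies them is known only under the double negation.
      ¬¬-excluded-middle {A = lower (F a i) ℝ.≤ lower (F b i)} λ lowers →
      ¬¬-excluded-middle {A = upper (F a i) ℝ.≤ upper (F b i)} λ uppers →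
      let x , x∈ , L-max = maximum lowers
          y , y∈ , U-min = minimum uppers
      in k (side i x y (¬below x∈ y∈) L-max U-min)
      where
      ¬below : ∀ {x y} → x ≡ a ⊎ x ≡ b → y ≡ a ⊎ y ≡ b → ¬ Below i y x
      ¬below (inj₁ refl) (inj₁ refl) = ¬below-self i a
      ¬below (inj₁ refl) (inj₂ refl) = proj₂ (apart i)
      ¬below (inj₂ refl) (inj₁ refl) = proj₁ (apart i)
      ¬below (inj₂ refl) (inj₂ refl) = ¬below-self i b
      maximum : Dec (lower (F a i) ℝ.≤ lower (F b i)) →
        ∃[ x ] ((x ≡ a ⊎ x ≡ b) × (∀ c → c ≡ a ⊎ c ≡ b → lower (F c i) ℝ.≤ lower (F x i)))
      maximum (yes a≤b) = b , inj₂ refl , λ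
        { c (inj₁ refl) → a≤b
        ; c (inj₂ refl) → ≤ℝ-refl {lower (F b i)} }
      maximum (no a≰b) = a , inj₁ refl , λ
        { c (inj₁ refl) → ≤ℝ-refl {lower (F a i)}
        ; c (inj₂ refl) → ≰ℝ⇒≥ℝ {lower (F a i)} {lower (F b i)} a≰b }
      minimum : Dec (upper (F a i) ℝ.≤ upper (F b i)) →
        ∃[ y ] ((y ≡ a ⊎ y ≡ b) × (∀ c → c ≡ a ⊎ c ≡ b → upper (F y i) ℝ.≤ upper (F c i)))
      minimum (yes a≤b) = a , inj₁ refl , λ
        { c (inj₁ refl) → ≤ℝ-refl {upper (F a i)}
        ; c (inj₂ refl) → a≤b }
      minimum (no a≰b) = b , inj₂ refl , λ
        { c (inj₁ refl) → ≰ℝ⇒≥ℝ {upper (F a i)} {upper (F b i)} a≰b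
        ; c (inj₂ refl) → ≤ℝ-refl {upper (F b i)} }

  module _ (below? : ∀ i a b → Dec (Below i a b)) where

    -- By `¬below-both` the two searches cannot both succeed, so their order does not affect the
    -- letter.
    letter : Fin N → Fin d → Maybe Bool
    letter a i with Fin.any? (below? i a)
    ... | yes _ = just false
    ... | no  _ with Fin.any? (λ b → below? i b a)
    ... | yes _ = just true
    ... | no  _ = nothing

    false⇒below : ∀ a i → letter a i ≡ just false → ∃[ b ] Below i a b
    false⇒below a i eq with Fin.any? (below? i a)
    ... | yes found = found
    ... | no  _ with Fin.any? (λ b → below? i b a)
    false⇒below a i () | no _ | yes _
    false⇒below a i () | no _ | no _

    true⇒below : ∀ a i → letter a i ≡ just true → ∃[ b ] Below i b a
    true⇒below a i eq with Fin.any? (below? i a)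
    true⇒below a i () | yes _
    ... | no  _ with Fin.any? (λ b → below? i b a)
    ... | yes found = found
    true⇒below a i () | no _ | no _

    letter-below : ∀ i a b → Below i a b → letter a i ≡ just false × letter b i ≡ just true
    letter-below i a b below = first , second
      where
      first : letter a i ≡ just false
      first with Fin.any? (below? i a)
      ... | yes _   = refl
      ... | no none = contradiction (b , below) none
      second : letter b i ≡ just true
      second with Fin.any? (below? i b)
      ... | yes (c , below′) = contradiction below′ (¬below-both i a b c below)
      ... | no _ with Fin.any? (λ c → below? i c b)
      ... | yes _   = refl
      ... | no none = contradiction (a , below) none

    conflict-below : ∀ i a b → Below i a b ⊎ Below i b a → conflict (letter a i) (letter b i) ≡ true
    conflict-below i a b (inj₁ below) with letter-below i a b below
    ... | p , q rewrite p | q = refl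
    conflict-below i a b (inj₂ below) with letter-below i b a below
    ... | p , q rewrite p | q = refl

    -- The letters of a and b may be due to other boxes, c above a and e below b. As the sides of c
    -- and e meet, the lower end of c is at most the upper end of e, which closes the chain from a
    -- to b.
    conflict⇒below : ∀ i a b → conflict (letter a i) (letter b i) ≡ true → Below i a b ⊎ Below i b a
    conflict⇒below i a b eq with letter a i in p | letter b i in q
    ... | just false | just true  = inj₁ (below a b (false⇒below a i p) (true⇒below b i q))
      where
      below : ∀ a b → ∃[ c ] Below i a c → ∃[ e ] Below i e b → Below i a b
      below a b (c , a≤c) (e , e≤b) = ≤ℝ-trans {upper (F a i)} {lower (F c i)} {lower (F b i)} a≤c
        (≤ℝ-trans {lower (F c i)} {upper (F e i)} {lower (F b i)} (common i c e) e≤b)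
    ... | just true  | just false = inj₂ (below b a (false⇒below b i q) (true⇒below a i p))
      where
      below : ∀ a b → ∃[ c ] Below i a c → ∃[ e ] Below i e b → Below i a b
      below a b (c , a≤c) (e , e≤b) = ≤ℝ-trans {upper (F a i)} {lower (F c i)} {lower (F b i)} a≤c
        (≤ℝ-trans {lower (F c i)} {upper (F e i)} {lower (F b i)} (common i c e) e≤b)

    word : Fin N → Word d
    word a = tabulate (letter a)

    word-disjoint : ∀ a b → a ≢ b → 1 ≤ dist (word a) (word b)
    word-disjoint a b a≢b with dist (word a) (word b) in eq
    ... | suc _ = s≤s z≤n
    ... | zero  = contradiction
      (λ i → (λ below → clash i (conflict-below i a b (inj₁ below)))
           , (λ below → clash i (conflict-below i a b (inj₂ below))))
      (someBelow a b a≢b)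
      where
      clash : ∀ i → ¬ conflict (letter a i) (letter b i) ≡ true
      clash i p with () ← trans (sym p) (dist≡0⇒¬conflict (letter a) (letter b) eq i)

    -- Each conflicting coordinate is constant on the intersection. More than k conflicts would
    -- leave fewer than d - k free coordinates, hence fewer than m, which is too few for m + 1
    -- independent points.
    word-close : ∀ a b → a ≢ b → dist (word a) (word b) ≤ k
    word-close a b a≢b =
      let m , d≤m+k , _ , dim , _ = intersections a b a≢b
          free , cover , size     = agreeing (letter a) (letter b)
      in ≮⇒≥ λ k<dist → flat-¬contains {S = ⟦ F a ⟧ ∩ ⟦ F b ⟧} free (λ i → Sum.map₂ (fixed i) (cover i))
           (+-cancelʳ-< (dist (word a) (word b)) (length free) m
             (≤-<-trans (≤-trans (≤-reflexive size) d≤m+k) (+-monoʳ-< m k<dist)))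
           (contains⁺ {S = ⟦ F a ⟧ ∩ ⟦ F b ⟧} dim)
      where
      fixed : ∀ i → conflict (letter a i) (letter b i) ≡ true →
              ∀ x y → (⟦ F a ⟧ ∩ ⟦ F b ⟧) x → (⟦ F a ⟧ ∩ ⟦ F b ⟧) y → x i ≃ y i
      fixed i clash x y (x∈a , x∈b) (y∈a , y∈b) with conflict⇒below i a b clash
      ... | inj₁ below = below⇒≃ i a b {x i} {y i} below (proj₁ (x∈b i)) (proj₂ (x∈a i)) (proj₁ (y∈b i)) (proj₂ (y∈a i))
      ... | inj₂ below = below⇒≃ i b a {x i} {y i} below (proj₁ (x∈a i)) (proj₂ (x∈b i)) (proj₁ (y∈a i)) (proj₂ (y∈b i))

    neighborlyWords : NeighborlyWords k word
    neighborlyWords = record { disjoint = word-disjoint ; close = word-close }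

  ¬¬-below? : ¬ ¬ (∀ i a b → Dec (Below i a b))
  ¬¬-below? = ¬¬-Fin λ i → ¬¬-Fin λ a → ¬¬-Fin λ b → ¬¬-excluded-middle

n≤-fromWords : ∀ {k d X} → WordBound k d X → n[ k , d ]≤ X
n≤-fromWords {X = X} bound N F neighborly = decidable-stable (fromℕ N ℚ.≤? X) λ ≰X →
  ¬¬-below? neighborly λ below? → ≰X (bound (word neighborly below?) (neighborlyWords neighborly below?))

-- Parity of d - k and the range of h

odd-form : ∀ {e} → ¬ (2 ∣ e) → e ≡ suc (2 * ⌊ e /2⌋)
odd-form {e} odd with parity-⌊n/2⌋ e
... | inj₁ (_ , e≡) = contradiction (divides ⌊ e /2⌋ (trans e≡ (double ⌊ e /2⌋))) odd
  where
  double : ∀ a → a + a ≡ a * 2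
  double = solve-∀
... | inj₂ (_ , e≡) = trans e≡ (cong (λ x → suc (⌊ e /2⌋ + x)) (sym (+-identityʳ _)))

-- The witness r becomes the number of summands in the sum over j.
double-split : ∀ h q → 2 * h + 2 ≤ 2 * q → ∃[ r ] q ≡ suc h + r
double-split h q le =
  let r , eq = m≤n⇒∃[o]m+o≡n (*-cancelˡ-≤ {suc h} {q} 2 (≤-trans (≤-reflexive (trans (*-suc 2 h) (+-comm 2 (2 * h)))) le))
  in r , sym eq

even-split : ∀ {e} h → 2 ∣ e → 2 * h + 2 ≤ e → ∃[ r ] e ≡ 2 * (suc h + r)
even-split h (divides q refl) le =
  let r , eq = double-split h q (≤-trans le (≤-reflexive (*-comm q 2)))
  in r , trans (*-comm q 2) (cong (2 *_) eq)

odd-split : ∀ {e} h → ¬ (2 ∣ e) → 2 * h + 3 ≤ e → ∃[ r ] e ≡ suc (2 * (suc h + r))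
odd-split {e} h odd le =
  let r , eq = double-split h ⌊ e /2⌋
                 (s≤s⁻¹ (≤-trans (≤-reflexive (sym (+-suc (2 * h) 2))) (≤-trans le (≤-reflexive (odd-form odd)))))
  in r , trans (odd-form odd) (cong (λ q → suc (2 * q)) eq)

theorem3p9 :
  (k d : ℕ) → 1 ≤ k → k < d →
  ( 2 ∣ d ∸ k →
    ∀ h → 2 * h + 2 ≤ d ∸ k →
    n[ k , d ]≤
      ( fromℕ (2 ^ h * binomialSum (d ∸ h) k)
        ⊔
        ( sumFromTo (suc h) ((d ∸ k ∸ 2) / 2)
            (λ j → (1/2^ (j + 1) ℚ.- 1/2^ (d ∸ k ∸ j)) ℚ.* fromℕ (∣B∣ (k + 2 * j) d))
          ℚ.+ fromℕ (2 ^ ((d + k) / 2)) ) ) )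
  ×
  ( ¬ (2 ∣ d ∸ k) →
    ( ∀ h → 2 * h + 3 ≤ d ∸ k →
      n[ k , d ]≤
        ( fromℕ (2 ^ h * binomialSum (d ∸ h) k)
          ⊔
          ( sumFromTo (suc h) ((d ∸ k ∸ 3) / 2)
              (λ j → (1/2^ (j + 1) ℚ.- 1/2^ (d ∸ k ∸ j)) ℚ.* fromℕ (∣B∣ (k + 2 * j) d))
            ℚ.+ 1/2^ ((d ∸ k + 1) / 2) ℚ.* fromℕ (∣B∣ (d ∸ 1) d)
            ℚ.+ fromℕ (2 ^ ((d + k ∸ 1) / 2)) ) ) )
    ×
    n[ k , d ]≤
      ( fromℕ (2 ^ ((d ∸ k ∸ 1) / 2) * binomialSum ((d + k + 1) / 2) k)
        ⊔ fromℕ (2 ^ ((d + k ∸ 1) / 2)) ) )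
theorem3p9 k d _ k<d =
  (λ 2∣e h 2h+2≤e → let r , e≡ = even-split h 2∣e 2h+2≤e in
    n≤-fromWords (bound-even k d h r (d ∸ k) k+e≡d e≡)) ,
  (λ 2∤e →
    (λ h 2h+3≤e → let r , e≡ = odd-split h 2∤e 2h+3≤e in
      n≤-fromWords (bound-odd k d h r (d ∸ k) k+e≡d e≡)) ,
    n≤-fromWords (bound-odd₂ k d ⌊ d ∸ k /2⌋ (d ∸ k) k+e≡d (odd-form 2∤e)))
  where
  k+e≡d : k + (d ∸ k) ≡ d
  k+e≡d = m+[n∸m]≡n (<⇒≤ k<d)
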